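{- Let $\boldsymbol{\mu}=(\mu_1,\dots,\mu_n)$ be an $n$-tuple of umbral monomials, let $\boldsymbol{\nu}_1,\ldots,\boldsymbol{\nu}_n$ be $m$-tuples of umbral monomials and, for $\boldsymbol{i}\in\mathbb{N}_0^m$, let $B_{\boldsymbol{i}}(x_1,\ldots,x_n)$ denote the generalized Bell polynomial associated with $\boldsymbol{\nu}_1,\dots,\boldsymbol{\nu}_n$. Then $$B_{\boldsymbol{i}}(\mu_1,\ldots,\mu_n)\simeq(\mu_1\boldsymbol{.}\beta\boldsymbol{.}\boldsymbol{\nu}_1+\cdots+\mu_n\boldsymbol{.}\beta\boldsymbol{.}\boldsymbol{\nu}_n)^{\boldsymbol{i}},$$ where $B_{\boldsymbol{i}}(\mu_1,\dots,\mu_n)$ is the umbral polynomial obtained by substituting $x_j\mapsto\mu_j$; that is, both sides have the same evaluation under $E$.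
   Context: $R$ is the real or complex field, $A$ is a set (the alphabet) whose elements are called umbrae, and $E:R[A]\to R$ is a linear functional (evaluation) with $E[1]=1$ and $E[\alpha^i\gamma^j\cdots]=E[\alpha^i]E[\gamma^j]\cdots$ for distinct umbrae and nonnegative integers $i,j,\dots$. Umbral equivalence $p\simeq q$ means $E[p]=E[q]$. Umbral monomials are monomials in $R[A]$; supports of the components of a tuple need not be disjoint. An $m$-tuple $\boldsymbol{\nu}$ of umbral monomials has moments $E[\boldsymbol{\nu}^{\boldsymbol{k}}]$, $\boldsymbol{\nu}^{\boldsymbol{k}}=\nu_1^{k_1}\cdots\nu_m^{k_m}$, $\boldsymbol{k}\in\mathbb{N}_0^m$, and generating function $f(\boldsymbol{\nu},\boldsymbol{t}_{(m)})=1+\sum_{\boldsymbol{k}\ne\boldsymbol{0}}E[\boldsymbol{\nu}^{\boldsymbol{k}}]\boldsymbol{t}_{(m)}^{\boldsymbol{k}}/\boldsymbol{k}!$, where $\boldsymbol{t}_{(m)}=(t_1,\dots,t_m)$, $\boldsymbol{k}!=k_1!\cdots k_m!$. Generalized Bell polynomial: $B_{\boldsymbol{i}}(x_1,\dots,x_n)\in R[x_1,\dots,x_n]$ is the coefficient of $\boldsymbol{t}_{(m)}^{\boldsymbol{i}}/\boldsymbol{i}!$ in $\exp\{\sum_{j=1}^n x_j[f(\boldsymbol{\nu}_j,\boldsymbol{t}_{(m)})-1]\}$. Partitions of a multi-index: a partition $\boldsymbol{\lambda}$ of $\boldsymbol{k}\in\mathbb{N}_0^m$, written $\boldsymbol{\lambda}\vdash\boldsymbol{k}$,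 is a matrix of nonnegative integers with $m$ rows, no zero column, columns in lexicographic order, and $r$-th row sum equal to $k_r$ (for $\boldsymbol{k}=\boldsymbol{0}$ only the empty one). Its number of columns is $l(\boldsymbol{\lambda})$. Writing $\boldsymbol{\lambda}=(\boldsymbol{\lambda}_1^{r_1},\boldsymbol{\lambda}_2^{r_2},\dots)$ when the distinct column $\boldsymbol{\lambda}_s$ occurs $r_s$ times, set $\mathfrak{m}(\boldsymbol{\lambda})!=r_1!r_2!\cdots$ and $\boldsymbol{\lambda}!=\prod_s(\boldsymbol{\lambda}_s!)^{r_s}$. With $h^{(j)}_{\boldsymbol{k}}=E[\boldsymbol{\nu}_j^{\boldsymbol{k}}]$ set $h^{(j)}_{\boldsymbol{\lambda}}=\prod_s(h^{(j)}_{\boldsymbol{\lambda}_s})^{r_s}$. The auxiliary umbra $\mu_1\boldsymbol{.}\beta\boldsymbol{.}\boldsymbol{\nu}_1+\cdots+\mu_n\boldsymbol{.}\beta\boldsymbol{.}\boldsymbol{\nu}_n$ ($\beta$ denotes the Bell umbra) is the symbolic $m$-tuple whose moments are computed by first treating $\mu_1,\dots,\mu_n$ as constants (indeterminates), with the summands mutually uncorrelated and $(\mu_j\boldsymbol{.}\beta\boldsymbol{.}\boldsymbol{\nu}_j)^{\boldsymbol{k}}$ evaluated to $\sum_{\boldsymbol{\lambda}\vdash\boldsymbol{k}}\frac{\boldsymbol{k}!}{\mathfrak{m}(\boldsymbol{\lambda})!\boldsymbol{\lambda}!}\mu_j^{l(\boldsymbol{\lambda})}h^{(j)}_{\boldsymbol{\lambda}}$,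 and then applying $E$ to the resulting polynomial in $\mu_1,\dots,\mu_n$. Explicitly its $\boldsymbol{i}$-th moment is $$\sum_{\boldsymbol{k}_1+\cdots+\boldsymbol{k}_n=\boldsymbol{i}}\frac{\boldsymbol{i}!}{\boldsymbol{k}_1!\cdots\boldsymbol{k}_n!}\sum_{\boldsymbol{\lambda}^{(1)}\vdash\boldsymbol{k}_1,\dots,\boldsymbol{\lambda}^{(n)}\vdash\boldsymbol{k}_n}\Big(\prod_{j=1}^n\frac{\boldsymbol{k}_j!}{\mathfrak{m}(\boldsymbol{\lambda}^{(j)})!\,\boldsymbol{\lambda}^{(j)}!}h^{(j)}_{\boldsymbol{\lambda}^{(j)}}\Big)E\big[\mu_1^{l(\boldsymbol{\lambda}^{(1)})}\cdots\mu_n^{l(\boldsymbol{\lambda}^{(n)})}\big].$$ -}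

module Defs where

open import Level using (Level; _⊔_) renaming (suc to lsuc)
open import Algebra.Bundles using (CommutativeRing)
open import Algebra.Apartness.Bundles using (HeytingField; HeytingCommutativeRing)
import Algebra.Definitions.RawMonoid as RawMonoidDefs
import Algebra.Properties.Monoid.Mult as Mult
import Algebra.Properties.Semiring.Exp as Exp
open import Data.Bool.Base using (if_then_else_)
open import Data.Fin.Base using (Fin)
open import Data.List.Base as List
  using (List; []; _∷_; _++_; concatMap; cartesianProductWith; deduplicate; filter; foldr; length; map; upTo)
import Data.List.Properties as Listₚ
open import Data.List.Membership.Propositional using (_∈_; _∉_; find; lose)
open import Data.List.Membership.Propositional.Properties
  using (∈-map⁺; ∈-map⁻; ∈-concatMap⁺; ∈-concatMap⁻; ∈-filter⁺; ∈-filter⁻; ∈-upTo⁺; ∈-upTo⁻;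
         ∈-cartesianProductWith⁺; ∈-cartesianProductWith⁻)
open import Data.List.Relation.Unary.All as All using (All; []; _∷_)
import Data.List.Relation.Unary.All.Properties as Allₚ
open import Data.List.Relation.Unary.AllPairs as AllPairs using (AllPairs; []; _∷_)
import Data.List.Relation.Unary.AllPairs.Properties as AllPairsₚ
open import Data.List.Relation.Unary.Any using (here; there)
open import Data.List.Relation.Unary.Linked using (Linked)
import Data.List.Relation.Unary.Linked.Properties as Linkedₚ
open import Data.List.Relation.Unary.Unique.Propositional using (Unique)
import Data.List.Relation.Unary.Unique.Propositional.Properties as Uniqueₚ
open import Data.List.Relation.Binary.Disjoint.Propositional using (Disjoint)
open import Data.Nat.Base as ℕ using (ℕ; zero; suc; z≤n; s≤s; _!)
import Data.Nat.Properties as ℕₚ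
open import Data.Nat.ListAction using (product)
open import Data.Product.Base using (∃; _×_; _,_; proj₁; proj₂)
open import Data.Vec.Base as Vec using (Vec; []; _∷_; lookup)
import Data.Vec.Properties as Vecₚ
import Data.Vec.Relation.Binary.Lex.Strict as Lex
open import Data.Vec.Relation.Binary.Pointwise.Inductive as Pointwise using (Pointwise; []; _∷_)
open import Function.Base using (_∘_; id)
open import Relation.Binary.Definitions using (DecidableEquality; Decidable)
open import Relation.Binary.Structures using (IsEquivalence)
open import Relation.Binary.PropositionalEquality as ≡
  using (_≡_; _≢_; refl; sym; trans; cong; cong₂; subst)
open import Relation.Nullary.Decidable using (⌊_⌋; yes; no; ¬?)
open import Relation.Nullary.Negation using (¬_; contradiction)

private
  variable
    b c ℓ ℓ₁ ℓ₂ a v w : Level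
    m n : ℕ

Index : ℕ → Set
Index m = Vec ℕ m

infixl 6 _+ᵢ_ _∸ᵢ_
infixl 7 _·ᵢ_
infix  4 _≤ᵢ_ _≟ᵢ_ _≤ᵢ?_ _<ₗ_ _≤ₗ_

0ᵢ : Index m
0ᵢ = Vec.replicate _ 0

_+ᵢ_ _∸ᵢ_ : Index m → Index m → Index m
_+ᵢ_ = Vec.zipWith ℕ._+_
_∸ᵢ_ = Vec.zipWith ℕ._∸_

_·ᵢ_ : ℕ → Index m → Index m
r ·ᵢ k = Vec.map (r ℕ.*_) k

∣_∣ᵢ : Index m → ℕ
∣_∣ᵢ = Vec.sum

_!ᵢ : Index m → ℕ
k !ᵢ = Vec.foldr′ ℕ._*_ 1 (Vec.map _! k)

_≤ᵢ_ : Index m → Index m → Set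
_≤ᵢ_ = Pointwise ℕ._≤_

_≟ᵢ_ : DecidableEquality (Index m)
_≟ᵢ_ = Vecₚ.≡-dec ℕₚ._≟_

_≤ᵢ?_ : Decidable (_≤ᵢ_ {m})
_≤ᵢ?_ = Pointwise.decidable ℕₚ._≤?_

_<ₗ_ _≤ₗ_ : Index m → Index m → Set
_<ₗ_ = Lex.Lex-< _≡_ ℕ._<_
_≤ₗ_ = Lex.Lex-≤ _≡_ ℕ._<_

below : Index m → List (Index m)
below []       = [] ∷ []
below (k ∷ ks) = cartesianProductWith _∷_ (upTo (suc k)) (below ks)

-- The n-tuples (k₁ , … , kₙ) with k₁ + ⋯ + kₙ = i.
decompositions : ∀ n → Index m → List (Vec (Index m) n)
decompositions zero    i = if ⌊ i ≟ᵢ 0ᵢ ⌋ then [] ∷ [] else []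
decompositions (suc n) i =
  concatMap (λ k → map (k ∷_) (decompositions n (i ∸ᵢ k))) (below i)

-- A matrix with m rows, as the list of its columns.
Columns : ℕ → Set
Columns m = List (Index m)

rowSums : Columns m → Index m
rowSums = foldr _+ᵢ_ 0ᵢ

infix 4 _⊢_

record _⊢_ {m} (λs : Columns m) (k : Index m) : Set where
  field
    nonzero : All (_≢ 0ᵢ) λs
    ordered : Linked _≤ₗ_ λs
    sums    : rowSums λs ≡ k

-- r is the multiplicity of the column c; the bound r ≤ ∣ k ∣ᵢ is no
-- restriction when c ≢ 0ᵢ.
partitionsInto : Columns m → Index m → List (Columns m)
partitionsInto []       k = if ⌊ k ≟ᵢ 0ᵢ ⌋ then [] ∷ [] else []
partitionsInto (c ∷ cs) k =
  concatMap (λ r → map (List.replicate r c ++_) (partitionsInto cs (k ∸ᵢ r ·ᵢ c)))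
            (filter (λ r → r ·ᵢ c ≤ᵢ? k) (upTo (suc ∣ k ∣ᵢ)))

nonzeroBelow : Index m → Columns m
nonzeroBelow k = filter (λ c → ¬? (c ≟ᵢ 0ᵢ)) (below k)

-- All λs with λs ⊢ k, without repetition; see ∈-partitions⁺, ∈-partitions⁻
-- and partitions-unique below.
partitions : Index m → List (Columns m)
partitions k = partitionsInto (nonzeroBelow k) k

distinctColumns : Columns m → List (Index m)
distinctColumns = deduplicate _≟ᵢ_

multiplicity : Index m → Columns m → ℕ
multiplicity c λs = length (filter (c ≟ᵢ_) λs)

𝔪[_]! : Columns m → ℕ
𝔪[ λs ]! = product (map (λ c → multiplicity c λs !) (distinctColumns λs))

_!ₚ : Columns m → ℕ
λs !ₚ = product (map (λ c → c !ᵢ ℕ.^ multiplicity c λs) (distinctColumns λs))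

choices : ∀ {X : Set b} → Vec (List X) n → List (Vec X n)
choices []         = [] ∷ []
choices (xs ∷ xss) = cartesianProductWith _∷_ xs (choices xss)

-- The enumerations above list exactly what they should, once each.

module Enumeration where

  +ᵢ-identityˡ : (k : Index m) → 0ᵢ +ᵢ k ≡ k
  +ᵢ-identityˡ = Vecₚ.zipWith-identityˡ ℕₚ.+-identityˡ

  +ᵢ-assoc : (x y z : Index m) → (x +ᵢ y) +ᵢ z ≡ x +ᵢ (y +ᵢ z)
  +ᵢ-assoc = Vecₚ.zipWith-assoc ℕₚ.+-assoc

  +-∸ᵢ : {x k : Index m} → x ≤ᵢ k → x +ᵢ (k ∸ᵢ x) ≡ k
  +-∸ᵢ []       = refl
  +-∸ᵢ (p ∷ ps) = cong₂ _∷_ (ℕₚ.m+[n∸m]≡n p) (+-∸ᵢ ps)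

  ∸-+ᵢ : (x y : Index m) → (x +ᵢ y) ∸ᵢ x ≡ y
  ∸-+ᵢ []       []       = refl
  ∸-+ᵢ (x ∷ xs) (y ∷ ys) = cong₂ _∷_ (ℕₚ.m+n∸m≡n x y) (∸-+ᵢ xs ys)

  ≤ᵢ-+ : (x y : Index m) → x ≤ᵢ x +ᵢ y
  ≤ᵢ-+ []       []       = []
  ≤ᵢ-+ (x ∷ xs) (y ∷ ys) = ℕₚ.m≤m+n x y ∷ ≤ᵢ-+ xs ys

  ≤ᵢ-trans : {x y z : Index m} → x ≤ᵢ y → y ≤ᵢ z → x ≤ᵢ z
  ≤ᵢ-trans = Pointwise.trans ℕₚ.≤-trans

  +ᵢ-≤ʳ : (x : Index m) {y z : Index m} → y ≤ᵢ z → y ≤ᵢ x +ᵢ z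
  +ᵢ-≤ʳ []       []       = []
  +ᵢ-≤ʳ (x ∷ xs) (p ∷ ps) = ℕₚ.m≤n⇒m≤o+n x p ∷ +ᵢ-≤ʳ xs ps

  ·ᵢ-zero : (c : Index m) → 0 ·ᵢ c ≡ 0ᵢ
  ·ᵢ-zero []       = refl
  ·ᵢ-zero (_ ∷ cs) = cong (0 ∷_) (·ᵢ-zero cs)

  ·ᵢ-suc : ∀ r (c : Index m) → suc r ·ᵢ c ≡ c +ᵢ r ·ᵢ c
  ·ᵢ-suc r []       = refl
  ·ᵢ-suc r (_ ∷ cs) = cong (_ ∷_) (·ᵢ-suc r cs)

  ∣∣ᵢ-mono : {x y : Index m} → x ≤ᵢ y → ∣ x ∣ᵢ ℕ.≤ ∣ y ∣ᵢ
  ∣∣ᵢ-mono []       = z≤n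
  ∣∣ᵢ-mono (p ∷ ps) = ℕₚ.+-mono-≤ p (∣∣ᵢ-mono ps)

  r≤∣r·c∣ : ∀ r {c : Index m} → c ≢ 0ᵢ → r ℕ.≤ ∣ r ·ᵢ c ∣ᵢ
  r≤∣r·c∣ r {[]}         c≢0 = contradiction refl c≢0
  r≤∣r·c∣ r {zero ∷ cs}  c≢0 =
    subst (λ z → r ℕ.≤ z ℕ.+ ∣ r ·ᵢ cs ∣ᵢ) (sym (ℕₚ.*-zeroʳ r))
      (r≤∣r·c∣ r {cs} (c≢0 ∘ cong (0 ∷_)))
  r≤∣r·c∣ r {suc c ∷ cs} _   =
    ℕₚ.≤-trans (ℕₚ.m≤m*n r (suc c)) (ℕₚ.m≤m+n _ _)

  rowSums-replicate : ∀ r (c : Index m) λs →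
                      rowSums (List.replicate r c ++ λs) ≡ r ·ᵢ c +ᵢ rowSums λs
  rowSums-replicate zero    c λs =
    trans (sym (+ᵢ-identityˡ _)) (cong (_+ᵢ rowSums λs) (sym (·ᵢ-zero c)))
  rowSums-replicate (suc r) c λs =
    trans (cong (c +ᵢ_) (rowSums-replicate r c λs))
      (trans (sym (+ᵢ-assoc c (r ·ᵢ c) _))
        (cong (_+ᵢ rowSums λs) (sym (·ᵢ-suc r c))))

  ∈-below⁺ : {x k : Index m} → x ≤ᵢ k → x ∈ below k
  ∈-below⁺ []       = here refl
  ∈-below⁺ (p ∷ ps) = ∈-cartesianProductWith⁺ _∷_ (∈-upTo⁺ (s≤s p)) (∈-below⁺ ps)

  ∈-below⁻ : (x k : Index m) → x ∈ below k → x ≤ᵢ k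
  ∈-below⁻ []       []       _ = []
  ∈-below⁻ (x ∷ xs) (k ∷ ks) p
    with _ , _ , q , q′ , refl ← ∈-cartesianProductWith⁻ _∷_ (upTo (suc k)) (below ks) p
    = ℕₚ.≤-pred (∈-upTo⁻ q) ∷ ∈-below⁻ xs ks q′

  below-increasing : (k : Index m) → AllPairs _<ₗ_ (below k)
  below-increasing []       = [] ∷ []
  below-increasing (k ∷ ks) = go (AllPairsₚ.applyUpTo⁺₁ id (suc k) (λ i<j _ → i<j))
    where
    go : ∀ {xs} → AllPairs ℕ._<_ xs →
         AllPairs _<ₗ_ (cartesianProductWith _∷_ xs (below ks))
    go []                = []
    go {x ∷ xs} (p ∷ ps) = AllPairsₚ.++⁺
      (AllPairsₚ.map⁺ (AllPairs.map (Lex.next refl) (below-increasing ks)))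
      (go ps)
      (Allₚ.map⁺ (All.universal (λ _ → All.tabulate λ y∈ → later y∈) (below ks)))
      where
      later : ∀ {y ys} → y ∈ cartesianProductWith _∷_ xs (below ks) → (x ∷ ys) <ₗ y
      later y∈ with _ , _ , q , _ , refl ← ∈-cartesianProductWith⁻ _∷_ xs (below ks) y∈
        = Lex.this (All.lookup p q) refl

  <ₗ-irrefl : {x : Index m} → ¬ (x <ₗ x)
  <ₗ-irrefl = Lex.<-irrefl ℕₚ.<-irrefl (Pointwise.refl refl)

  <-≤ₗ-trans : {x y z : Index m} → x <ₗ y → y ≤ₗ z → x <ₗ z
  <-≤ₗ-trans = Lex.<-transˡ (IsEquivalence.isPartialEquivalence ≡.isEquivalence) (≡.resp₂ ℕ._<_) ℕₚ.<-trans

  ≤ₗ-refl : {x : Index m} → x ≤ₗ x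
  ≤ₗ-refl = Lex.≤-refl (Pointwise.refl refl)

  ≤ₗ-trans : {x y z : Index m} → x ≤ₗ y → y ≤ₗ z → x ≤ₗ z
  ≤ₗ-trans = Lex.≤-trans (IsEquivalence.isPartialEquivalence ≡.isEquivalence) (≡.resp₂ ℕ._<_) ℕₚ.<-trans

  increasing⇒unique : {cs : Columns m} → AllPairs _<ₗ_ cs → Unique cs
  increasing⇒unique = AllPairs.map λ { x<x refl → <ₗ-irrefl x<x }

  nonzeroBelow-increasing : (k : Index m) → AllPairs _<ₗ_ (nonzeroBelow k)
  nonzeroBelow-increasing k = AllPairsₚ.filter⁺ _ (below-increasing k)

  partitionsInto-step⁺ : ∀ (c : Index m) cs {k μs} r →
    c ≢ 0ᵢ → r ·ᵢ c ≤ᵢ k → μs ∈ partitionsInto cs (k ∸ᵢ r ·ᵢ c) →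
    List.replicate r c ++ μs ∈ partitionsInto (c ∷ cs) k
  partitionsInto-step⁺ c cs {k} r c≢0 rc≤k p =
    ∈-concatMap⁺ (λ r → map (List.replicate r c ++_) (partitionsInto cs (k ∸ᵢ r ·ᵢ c))) (lose
      (∈-filter⁺ (λ r → r ·ᵢ c ≤ᵢ? k) (∈-upTo⁺ (s≤s (ℕₚ.≤-trans (r≤∣r·c∣ r c≢0) (∣∣ᵢ-mono rc≤k)))) rc≤k)
      (∈-map⁺ _ p))

  partitionsInto-step⁻ : ∀ (c : Index m) cs {k λs} → λs ∈ partitionsInto (c ∷ cs) k →
    ∃ λ r → ∃ λ μs → r ·ᵢ c ≤ᵢ k × μs ∈ partitionsInto cs (k ∸ᵢ r ·ᵢ c)
                   × λs ≡ List.replicate r c ++ μs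
  partitionsInto-step⁻ c cs {k} p
    with r , r∈ , q ← find (∈-concatMap⁻ _ {xs = filter (λ r → r ·ᵢ c ≤ᵢ? k) (upTo (suc ∣ k ∣ᵢ))} p)
    with μs , μs∈ , λs≡ ← ∈-map⁻ _ q
    = r , μs , proj₂ (∈-filter⁻ (λ r → r ·ᵢ c ≤ᵢ? k) {xs = upTo (suc ∣ k ∣ᵢ)} r∈) , μs∈ , λs≡

  rowSums-into : ∀ (cs : Columns m) {k λs} → λs ∈ partitionsInto cs k → rowSums λs ≡ k
  rowSums-into []       {k} p with k ≟ᵢ 0ᵢ | p
  ... | yes refl | here refl = refl
  rowSums-into (c ∷ cs) {k} p
    with r , μs , rc≤k , μs∈ , refl ← partitionsInto-step⁻ c cs p
    = trans (rowSums-replicate r c μs)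
        (trans (cong (r ·ᵢ c +ᵢ_) (rowSums-into cs μs∈)) (+-∸ᵢ rc≤k))

  columns-into : ∀ (cs : Columns m) {k λs} → λs ∈ partitionsInto cs k → All (_∈ cs) λs
  columns-into []       {k} p with k ≟ᵢ 0ᵢ | p
  ... | yes _ | here refl = []
  columns-into (c ∷ cs) p
    with r , μs , _ , μs∈ , refl ← partitionsInto-step⁻ c cs p
    = Allₚ.++⁺ (Allₚ.replicate⁺ r (here refl)) (All.map there (columns-into cs μs∈))

  ordered-replicate : ∀ r {x : Index m} {μs} → All (x ≤ₗ_) μs → AllPairs _≤ₗ_ μs →
                      AllPairs _≤ₗ_ (List.replicate r x ++ μs)
  ordered-replicate zero    _ q = q
  ordered-replicate (suc r) p q =
    Allₚ.++⁺ (Allₚ.replicate⁺ r ≤ₗ-refl) p ∷ ordered-replicate r p q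

  ordered-into : ∀ {cs : Columns m} → AllPairs _<ₗ_ cs →
                 ∀ {k λs} → λs ∈ partitionsInto cs k → AllPairs _≤ₗ_ λs
  ordered-into []       {k} p with k ≟ᵢ 0ᵢ | p
  ... | yes _ | here refl = []
  ordered-into {cs = c ∷ cs} (c< ∷ inc) p
    with r , μs , _ , μs∈ , refl ← partitionsInto-step⁻ c cs p
    = ordered-replicate r
        (All.map (λ x∈ → Lex.<⇒≤ (All.lookup c< x∈)) (columns-into cs μs∈))
        (ordered-into inc μs∈)

  split : ∀ {c : Index m} {cs} → All (c <ₗ_) cs → ∀ {λs} → AllPairs _≤ₗ_ λs →
          All (_∈ c ∷ cs) λs →
          ∃ λ r → ∃ λ μs → λs ≡ List.replicate r c ++ μs × AllPairs _≤ₗ_ μs × All (_∈ cs) μs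
  split c< []                    []               = 0 , [] , refl , [] , []
  split c< (_  ∷ ord)            (here refl ∷ ps)
    with r , μs , refl , ord′ , ps′ ← split c< ord ps = suc r , μs , refl , ord′ , ps′
  split {c = c} {cs} c< {x ∷ xs} (x≤ ∷ ord) (there x∈ ∷ ps) =
    0 , x ∷ xs , refl , x≤ ∷ ord , x∈ ∷ All.zipWith later (x≤ , ps)
    where
    later : ∀ {y} → x ≤ₗ y × y ∈ c ∷ cs → y ∈ cs
    later (x≤y , here refl) = contradiction (<-≤ₗ-trans (All.lookup c< x∈) x≤y) <ₗ-irrefl
    later (_   , there y∈)  = y∈

  into-complete : ∀ {cs : Columns m} → AllPairs _<ₗ_ cs → All (_≢ 0ᵢ) cs →
                  ∀ {λs} → AllPairs _≤ₗ_ λs → All (_∈ cs) λs →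
                  λs ∈ partitionsInto cs (rowSums λs)
  into-complete {m} {[]} _ _ {[]} _ _ with 0ᵢ {m} ≟ᵢ 0ᵢ
  ... | yes _ = here refl
  ... | no ¬p = contradiction refl ¬p
  into-complete {cs = []} _ _ {_ ∷ _} _ (() ∷ _)
  into-complete {cs = c ∷ cs} (c< ∷ inc) (c≢0 ∷ nz) ord ps
    with r , μs , refl , ord′ , ps′ ← split c< ord ps =
    subst (λ z → List.replicate r c ++ μs ∈ partitionsInto (c ∷ cs) z)
      (sym (rowSums-replicate r c μs))
      (partitionsInto-step⁺ c cs r c≢0 (≤ᵢ-+ _ _)
        (subst (λ z → μs ∈ partitionsInto cs z) (sym (∸-+ᵢ (r ·ᵢ c) _))
          (into-complete inc nz ord′ ps′)))

  replicate-injective : ∀ {c : Index m} {cs} → c ∉ cs → ∀ r r′ {μs μs′} →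
    All (_∈ cs) μs → All (_∈ cs) μs′ →
    List.replicate r c ++ μs ≡ List.replicate r′ c ++ μs′ → r ≡ r′
  replicate-injective c∉ zero    zero     _        _        _    = refl
  replicate-injective c∉ (suc r) (suc r′) ps       ps′      eq   =
    cong suc (replicate-injective c∉ r r′ ps ps′ (Listₚ.∷-injectiveʳ eq))
  replicate-injective c∉ zero    (suc r′) (c∈ ∷ _) _        refl = contradiction c∈ c∉
  replicate-injective c∉ (suc r) zero     _        (c∈ ∷ _) refl = contradiction c∈ c∉

  into-unique : ∀ {cs : Columns m} → Unique cs → ∀ k → Unique (partitionsInto cs k)
  into-unique []       k with k ≟ᵢ 0ᵢ
  ... | yes _ = [] ∷ []
  ... | no _  = []
  into-unique {cs = c ∷ cs} (c≢ ∷ u) k = Uniqueₚ.concat⁺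
    (Allₚ.map⁺ (All.universal (λ r → Uniqueₚ.map⁺ (Listₚ.++-cancelˡ _ _ _)
      (into-unique u (k ∸ᵢ r ·ᵢ c))) rs))
    (AllPairsₚ.map⁺ (AllPairs.map disjoint (Uniqueₚ.filter⁺ (λ r → r ·ᵢ c ≤ᵢ? k) (Uniqueₚ.upTo⁺ (suc ∣ k ∣ᵢ)))))
    where
    rs = filter (λ r → r ·ᵢ c ≤ᵢ? k) (upTo (suc ∣ k ∣ᵢ))

    c∉ : c ∉ cs
    c∉ c∈ = All.lookup c≢ c∈ refl

    block : ℕ → List (Columns _)
    block r = map (List.replicate r c ++_) (partitionsInto cs (k ∸ᵢ r ·ᵢ c))

    disjoint : ∀ {r r′} → r ≢ r′ → Disjoint (block r) (block r′)
    disjoint {r} {r′} r≢r′ (p , q)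
      with μs , μs∈ , refl ← ∈-map⁻ _ p | μs′ , μs′∈ , eq ← ∈-map⁻ _ q
      = r≢r′ (replicate-injective c∉ r r′ (columns-into cs μs∈) (columns-into cs μs′∈) eq)

  columns≤rowSums : (λs : Columns m) → All (_≤ᵢ rowSums λs) λs
  columns≤rowSums []       = []
  columns≤rowSums (x ∷ λs) =
    ≤ᵢ-+ x _ ∷ All.map (+ᵢ-≤ʳ x) (columns≤rowSums λs)

open Enumeration

∈-partitions⁺ : {λs : Columns m} {k : Index m} → λs ⊢ k → λs ∈ partitions k
∈-partitions⁺ {λs = λs} record { nonzero = nz ; ordered = ord ; sums = refl } =
  into-complete (nonzeroBelow-increasing k)
    (Allₚ.all-filter (λ c → ¬? (c ≟ᵢ 0ᵢ)) (below k))
    (Linkedₚ.Linked⇒AllPairs ≤ₗ-trans ord)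
    (All.zipWith (λ { (c≤ , c≢0) → ∈-filter⁺ _ (∈-below⁺ c≤) c≢0 }) (columns≤rowSums λs , nz))
  where k = rowSums λs

∈-partitions⁻ : {λs : Columns m} {k : Index m} → λs ∈ partitions k → λs ⊢ k
∈-partitions⁻ {k = k} p = record
  { nonzero = All.map (λ c∈ → proj₂ (∈-filter⁻ (λ c → ¬? (c ≟ᵢ 0ᵢ)) {xs = below k} c∈))
                      (columns-into (nonzeroBelow k) p)
  ; ordered = Linkedₚ.AllPairs⇒Linked (ordered-into (nonzeroBelow-increasing k) p)
  ; sums    = rowSums-into (nonzeroBelow k) p
  }

partitions-unique : (k : Index m) → Unique (partitions k)
partitions-unique k = into-unique (increasing⇒unique (nonzeroBelow-increasing k)) k

∈-decompositions⁺ : {i : Index m} (ks : Vec (Index m) n) →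
                    Vec.foldr′ _+ᵢ_ 0ᵢ ks ≡ i → ks ∈ decompositions n i
∈-decompositions⁺ {m} [] refl with 0ᵢ {m} ≟ᵢ 0ᵢ
... | yes _ = here refl
... | no ¬p = contradiction refl ¬p
∈-decompositions⁺ (k ∷ ks) refl =
  ∈-concatMap⁺ _ (lose (∈-below⁺ (≤ᵢ-+ k _))
    (∈-map⁺ _ (∈-decompositions⁺ ks (sym (∸-+ᵢ k _)))))

∈-decompositions⁻ : (i : Index m) (ks : Vec (Index m) n) →
                    ks ∈ decompositions n i → Vec.foldr′ _+ᵢ_ 0ᵢ ks ≡ i
∈-decompositions⁻ i []       p with i ≟ᵢ 0ᵢ | p
... | yes refl | here refl = refl
∈-decompositions⁻ i (k ∷ ks) p
  with k , k∈ , q ← find (∈-concatMap⁻ _ {xs = below i} p)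
  with ks , ks∈ , refl ← ∈-map⁻ _ q
  = trans (cong (k +ᵢ_) (∈-decompositions⁻ (i ∸ᵢ k) ks ks∈)) (+-∸ᵢ (∈-below⁻ k i k∈))

decompositions-unique : ∀ n (i : Index m) → Unique (decompositions n i)
decompositions-unique zero    i with i ≟ᵢ 0ᵢ
... | yes _ = [] ∷ []
... | no _  = []
decompositions-unique (suc n) i = Uniqueₚ.concat⁺
  (Allₚ.map⁺ (All.universal (λ k → Uniqueₚ.map⁺ Vecₚ.∷-injectiveʳ
    (decompositions-unique n (i ∸ᵢ k))) (below i)))
  (AllPairsₚ.map⁺ (AllPairs.map disjoint (increasing⇒unique (below-increasing i))))
  where
  block : Index _ → List (Vec (Index _) (suc n))
  block k = map (k ∷_) (decompositions n (i ∸ᵢ k))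

  disjoint : ∀ {k k′} → k ≢ k′ → Disjoint (block k) (block k′)
  disjoint k≢k′ (p , q)
    with _ , _ , refl ← ∈-map⁻ _ p | _ , _ , eq ← ∈-map⁻ _ q
    = k≢k′ (Vecₚ.∷-injectiveˡ eq)

-- The real and the complex field are both instances.
record CharacteristicZeroField c ℓ₁ ℓ₂ : Set (lsuc (c ⊔ ℓ₁ ⊔ ℓ₂)) where
  field
    heytingField : HeytingField c ℓ₁ ℓ₂

  open HeytingField heytingField public

  commutativeRing : CommutativeRing c ℓ₁
  commutativeRing = HeytingCommutativeRing.commutativeRing heytingCommutativeRing

  open Mult (CommutativeRing.+-monoid commutativeRing) using () renaming (_×_ to _×ᴿ_)

  fromℕ : ℕ → Carrier
  fromℕ n = n ×ᴿ 1#

  field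
    characteristicZero : ∀ n → fromℕ (suc n) # 0#

  -- recip 0 is never used: every denominator below is a product of
  -- factorials.
  recip : ℕ → Carrier
  recip zero    = 0#
  recip (suc n) = proj₁ (#⇒invertible (characteristicZero n))

  infixl 7 _÷_

  _÷_ : ℕ → ℕ → Carrier
  p ÷ q = fromℕ p * recip q

-- Polynomial rings: Poly V with _≋_ is the free commutative R-algebra on V.
module Polynomials (R : CommutativeRing c ℓ) where

  private module R = CommutativeRing R

  infix  8 ⊝_
  infixl 7 _⊗_
  infixl 6 _⊕_
  infix  4 _≋_

  data Poly (V : Set v) : Set (c ⊔ v) where
    con     : R.Carrier → Poly V
    var     : V → Poly V
    _⊕_ _⊗_ : Poly V → Poly V → Poly V
    ⊝_      : Poly V → Poly V

  data _≋_ {V : Set v} : Poly V → Poly V → Set (c ⊔ ℓ ⊔ v) where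
    ≋-refl  : ∀ {p} → p ≋ p
    ≋-sym   : ∀ {p q} → p ≋ q → q ≋ p
    ≋-trans : ∀ {p q r} → p ≋ q → q ≋ r → p ≋ r
    ⊕-cong  : ∀ {p p′ q q′} → p ≋ p′ → q ≋ q′ → p ⊕ q ≋ p′ ⊕ q′
    ⊗-cong  : ∀ {p p′ q q′} → p ≋ p′ → q ≋ q′ → p ⊗ q ≋ p′ ⊗ q′
    ⊝-cong  : ∀ {p p′} → p ≋ p′ → ⊝ p ≋ ⊝ p′

    ⊕-assoc     : ∀ p q r → (p ⊕ q) ⊕ r ≋ p ⊕ (q ⊕ r)
    ⊕-comm      : ∀ p q → p ⊕ q ≋ q ⊕ p
    ⊕-identityˡ : ∀ p → con R.0# ⊕ p ≋ p
    ⊝-inverseˡ  : ∀ p → ⊝ p ⊕ p ≋ con R.0#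
    ⊗-assoc     : ∀ p q r → (p ⊗ q) ⊗ r ≋ p ⊗ (q ⊗ r)
    ⊗-comm      : ∀ p q → p ⊗ q ≋ q ⊗ p
    ⊗-identityˡ : ∀ p → con R.1# ⊗ p ≋ p
    ⊗-distribʳ  : ∀ p q r → (q ⊕ r) ⊗ p ≋ q ⊗ p ⊕ r ⊗ p

    con-cong : ∀ {r s} → r R.≈ s → con r ≋ con s
    con-⊕    : ∀ r s → con (r R.+ s) ≋ con r ⊕ con s
    con-⊗    : ∀ r s → con (r R.* s) ≋ con r ⊗ con s

  polyRing : Set v → CommutativeRing _ _
  polyRing V = record
    { Carrier = Poly V
    ; _≈_     = _≋_
    ; _+_     = _⊕_
    ; _*_     = _⊗_
    ; -_      = ⊝_
    ; 0#      = con R.0#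
    ; 1#      = con R.1#
    ; isCommutativeRing = record
      { isRing = record
        { +-isAbelianGroup = record
          { isGroup = record
            { isMonoid = record
              { isSemigroup = record
                { isMagma = record
                  { isEquivalence = record
                    { refl = ≋-refl ; sym = ≋-sym ; trans = ≋-trans }
                  ; ∙-cong = ⊕-cong
                  }
                ; assoc = ⊕-assoc
                }
              ; identity = ⊕-identityˡ , λ p → ≋-trans (⊕-comm _ _) (⊕-identityˡ p)
              }
            ; inverse = ⊝-inverseˡ , λ p → ≋-trans (⊕-comm _ _) (⊝-inverseˡ p)
            ; ⁻¹-cong = ⊝-cong
            }
          ; comm = ⊕-comm
          }
        ; *-cong     = ⊗-cong
        ; *-assoc    = ⊗-assoc
        ; *-identity = ⊗-identityˡ , λ p → ≋-trans (⊗-comm _ _) (⊗-identityˡ p)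
        ; distrib    =
            (λ p q r → ≋-trans (⊗-comm _ _)
              (≋-trans (⊗-distribʳ p q r) (⊕-cong (⊗-comm _ _) (⊗-comm _ _))))
          , ⊗-distribʳ
        }
      ; *-comm = ⊗-comm
      }
    }

  infix 9 _[_]

  _[_] : {V : Set v} {W : Set w} → Poly V → (V → Poly W) → Poly W
  con r   [ σ ] = con r
  var x   [ σ ] = σ x
  (p ⊕ q) [ σ ] = p [ σ ] ⊕ q [ σ ]
  (p ⊗ q) [ σ ] = p [ σ ] ⊗ q [ σ ]
  (⊝ p)   [ σ ] = ⊝ (p [ σ ])

  []-cong : {V : Set v} {W : Set w} {p q : Poly V} (σ : V → Poly W) →
            p ≋ q → p [ σ ] ≋ q [ σ ]
  []-cong σ ≋-refl              = ≋-refl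
  []-cong σ (≋-sym e)           = ≋-sym ([]-cong σ e)
  []-cong σ (≋-trans e f)       = ≋-trans ([]-cong σ e) ([]-cong σ f)
  []-cong σ (⊕-cong e f)        = ⊕-cong ([]-cong σ e) ([]-cong σ f)
  []-cong σ (⊗-cong e f)        = ⊗-cong ([]-cong σ e) ([]-cong σ f)
  []-cong σ (⊝-cong e)          = ⊝-cong ([]-cong σ e)
  []-cong σ (⊕-assoc p q r)     = ⊕-assoc _ _ _
  []-cong σ (⊕-comm p q)        = ⊕-comm _ _
  []-cong σ (⊕-identityˡ p)     = ⊕-identityˡ _
  []-cong σ (⊝-inverseˡ p)      = ⊝-inverseˡ _
  []-cong σ (⊗-assoc p q r)     = ⊗-assoc _ _ _
  []-cong σ (⊗-comm p q)        = ⊗-comm _ _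
  []-cong σ (⊗-identityˡ p)     = ⊗-identityˡ _
  []-cong σ (⊗-distribʳ p q r)  = ⊗-distribʳ _ _ _
  []-cong σ (con-cong e)        = con-cong e
  []-cong σ (con-⊕ r s)         = con-⊕ r s
  []-cong σ (con-⊗ r s)         = con-⊗ r s

module BigOperators (R : CommutativeRing c ℓ) where

  open CommutativeRing R

  infixr 5 ∑ ∏

  ∑ ∏ : {B : Set b} → List B → (B → Carrier) → Carrier
  ∑ xs f = foldr (λ x s → f x + s) 0# xs
  ∏ xs f = foldr (λ x s → f x * s) 1# xs

  ∑ᶠ ∏ᶠ : (Fin n → Carrier) → Carrier
  ∑ᶠ = RawMonoidDefs.sum +-rawMonoid
  ∏ᶠ = RawMonoidDefs.sum *-rawMonoid

  open Exp semiring using (_^_) public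

  infixl 8 _^ᵐ_

  _^ᵐ_ : (Fin m → Carrier) → Vec ℕ m → Carrier
  x ^ᵐ k = ∏ᶠ λ r → x r ^ lookup k r

  syntax ∑ xs (λ x → e) = ∑[ x ∈ xs ] e
  syntax ∏ xs (λ x → e) = ∏[ x ∈ xs ] e

module FormalSeries
  (R : CommutativeRing c ℓ) (recip : ℕ → CommutativeRing.Carrier R) (m : ℕ) where

  open CommutativeRing R
  open BigOperators R using (∑)

  -- F k is the coefficient of t^k.
  Series : Set c
  Series = Index m → Carrier

  1ₛ : Series
  1ₛ k = if ⌊ k ≟ᵢ 0ᵢ ⌋ then 1# else 0#

  infixl 7 _*ₛ_
  infixr 8 _^ₛ_

  _*ₛ_ : Series → Series → Series
  (F *ₛ G) i = ∑[ k ∈ below i ] F k * G (i ∸ᵢ k)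

  _^ₛ_ : Series → ℕ → Series
  F ^ₛ zero  = 1ₛ
  F ^ₛ suc r = F *ₛ F ^ₛ r

  -- The exponential ∑ᵣ F^r / r! of a series F without constant term: F^r has
  -- no terms of total degree below r, so only r ≤ ∣ i ∣ᵢ contribute to the
  -- coefficient of t^i.
  expₛ : Series → Series
  expₛ F i = ∑[ r ∈ upTo (suc ∣ i ∣ᵢ) ] recip (r !) * (F ^ₛ r) i

-- Umbral monomials, as words in the umbrae; the order is irrelevant since
-- only the product of the letters is used.
Monomial : Set a → Set a
Monomial A = List A

record Evaluation (K : CharacteristicZeroField c ℓ₁ ℓ₂) (A : Set a)
       : Set (c ⊔ ℓ₁ ⊔ a) where

  open CharacteristicZeroField K
  open Polynomials commutativeRing
  private
    module S = BigOperators commutativeRing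
    module T = BigOperators (polyRing A)

  field
    E            : Poly A → Carrier
    E-cong       : ∀ {p q} → p ≋ q → E p ≈ E q
    E-additive   : ∀ p q → E (p ⊕ q) ≈ E p + E q
    E-scalar     : ∀ r p → E (con r ⊗ p) ≈ r * E p
    E-1          : E (con 1#) ≈ 1#
    uncorrelated : (αs : List (A × ℕ)) → Unique (map proj₁ αs) →
                   E (T.∏ αs λ (α , i) → var α T.^ i) ≈
                   S.∏ αs λ (α , i) → E (var α T.^ i)

module Umbral (K : CharacteristicZeroField c ℓ₁ ℓ₂) {A : Set a} (ev : Evaluation K A) where

  open CharacteristicZeroField K
  open Polynomials commutativeRing
  open Evaluation ev
  open BigOperators commutativeRing
  private
    module PolyA = BigOperators (polyRing A)

  ⟦_⟧ : Monomial A → Poly A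
  ⟦ αs ⟧ = PolyA.∏ αs var

  moment : (Fin m → Monomial A) → Index m → Carrier
  moment ν k = E ((λ r → ⟦ ν r ⟧) PolyA.^ᵐ k)

  generatingFunction : (Fin m → Monomial A) → Index m → Carrier
  generatingFunction ν k = if ⌊ k ≟ᵢ 0ᵢ ⌋ then 1# else moment ν k * recip (k !ᵢ)

  module _ (ν : Fin n → Fin m → Monomial A) where

    private
      module Kx = CommutativeRing (polyRing (Fin n))
      module PolyX = BigOperators (polyRing (Fin n))

    open FormalSeries (polyRing (Fin n)) (λ r → con (recip r)) m

    bellExponent : Series
    bellExponent k = PolyX.∑ᶠ λ j → var j ⊗ (con (generatingFunction (ν j) k) Kx.- 1ₛ k)

    bell : Index m → Poly (Fin n)
    bell i = con (fromℕ (i !ᵢ)) ⊗ expₛ bellExponent i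

  partitionMoment : (Fin m → Monomial A) → Columns m → Carrier
  partitionMoment ν λs = ∏[ c ∈ distinctColumns λs ] moment ν c ^ multiplicity c λs

  -- The i-th moment of μ₁.β.ν₁ + ⋯ + μₙ.β.νₙ.
  auxiliaryMoment : (Fin n → Monomial A) → (Fin n → Fin m → Monomial A) → Index m → Carrier
  auxiliaryMoment {n = n} μ ν i =
    ∑[ ks ∈ decompositions n i ]
      i !ᵢ ÷ Vec.foldr′ ℕ._*_ 1 (Vec.map _!ᵢ ks) *
      (∑[ λs ∈ choices (Vec.map partitions ks) ]
        ∏ᶠ (λ j → lookup ks j !ᵢ ÷ (𝔪[ lookup λs j ]! ℕ.* lookup λs j !ₚ)
                  * partitionMoment (ν j) (lookup λs j)) *
        moment μ (Vec.map length λs))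

{-# OPTIONS --safe #-}

-- On series without constant term exp turns sums into products, since the
-- divided powers F^r / r! satisfy the binomial identity.  Applied to the sum
-- over j this turns the Bell polynomial into a sum over the decompositions of
-- i; applied to the sum of the monomials x_j g_e t^e of one exponent, where
-- exp (a t^e) = ∑ᵣ (a^r / r!) t^(r e), it produces the multiplicities of the
-- columns e, hence the sum over partitions.  Evaluating the resulting expansion
-- in monomials of x₁ , … , xₙ term by term gives the auxiliary moment.
module Submission where

open import Defs
open import Level using (Level)
open import Algebra.Bundles using (CommutativeMonoid; CommutativeRing)
import Algebra.Properties.CommutativeMonoid.Mult as CommutativeMonoidMult
import Algebra.Properties.CommutativeMonoid.Sum as CommutativeMonoidSum
import Algebra.Properties.CommutativeSemigroup as CommutativeSemigroupProperties
import Algebra.Properties.CommutativeSemiring.Exp as CommutativeSemiringExp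
import Algebra.Properties.Ring as RingProperties
import Algebra.Properties.Semiring.Mult as SemiringMult
open import Data.Bool.Base using (if_then_else_)
open import Data.Fin.Base using (Fin; zero; suc)
open import Data.List.Base as List using (List; []; _∷_; _++_; _∷ʳ_; concatMap; cartesianProductWith; filter; foldr; map; upTo)
open import Data.List.Membership.Propositional using (_∈_; _∉_)
open import Data.List.Membership.Propositional.Properties using (∈-upTo⁻; ∈-filter⁺; ∈-deduplicate⁻)
import Data.List.Properties as Listₚ
open import Data.List.Relation.Unary.All as All using (All; []; _∷_)
import Data.List.Relation.Unary.All.Properties as Allₚ
open import Data.List.Relation.Unary.AllPairs using ([]; _∷_)
open import Data.List.Relation.Unary.Any using (here; there)
open import Data.List.Relation.Unary.Unique.Propositional using (Unique)
open import Data.Nat.Base as ℕ using (ℕ; zero; suc; z≤n; s≤s; _∸_; NonZero; _!)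
open import Data.Nat.ListAction using (product)
open import Data.Nat.ListAction.Properties using (product≢0)
import Data.Nat.Properties as ℕₚ
open import Data.Product.Base using (_,_; proj₁; proj₂)
open import Data.Vec.Base as Vec using (Vec; []; _∷_; lookup)
import Data.Vec.Properties as Vecₚ
open import Data.Vec.Relation.Binary.Pointwise.Inductive using ([]; _∷_)
open import Function.Base using (_∘_)
open import Relation.Binary.Definitions using (DecidableEquality)
open import Relation.Binary.PropositionalEquality as ≡ using (_≡_; _≢_; refl)
import Relation.Binary.Reasoning.Setoid as SetoidReasoning
open import Relation.Nullary.Decidable using (⌊_⌋; Dec; yes; no; ¬?)
open import Relation.Nullary.Negation using (contradiction)
open import Relation.Unary using (Pred) renaming (Decidable to Decidable₁)

-- The components of `μ` may share umbrae, so E cannot be applied to them factor by factor. Hence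
-- everything up to the expansion in monomials takes place over the polynomial ring in x_1, ...,
-- x_n, where the x_j are independent and the moments of the `ν j` are constants; substitution and E
-- come last, and each monomial then yields one joint moment of `μ`. This is why the series below
-- have coefficients in an arbitrary commutative ring with a chosen function `recip`. The main
-- obstacle is that `expₛ` is a finite sum whose cutoff depends on the index: the law exp (F + G) =
-- exp F exp G compares sums of different lengths. It holds because the cutoff is the total degree,
-- which is additive, and because powers of a series without constant term vanish beyond it. The
-- match with the two combinatorial sums is obtained without bijections: `decompositions` and
-- `partitionsInto` recurse by choosing one index, respectively the number of copies of one column,
-- and each such choice corresponds to splitting one summand off the exponent.

private
  variable
    b b′ c ℓ p : Level
    m n : ℕ
    B : Set b
    B′ : Set b′

-- Finite sums and products over lists

module ListFold (M : CommutativeMonoid c ℓ) where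
  open CommutativeMonoid M renaming (refl to ≈-refl)
  open SetoidReasoning setoid
  open CommutativeSemigroupProperties commutativeSemigroup using (interchange)

  fold : List B → (B → Carrier) → Carrier
  fold xs f = foldr (λ x s → f x ∙ s) ε xs

  fold-cong-∈ : (xs : List B) {f g : B → Carrier} →
                (∀ x → x ∈ xs → f x ≈ g x) → fold xs f ≈ fold xs g
  fold-cong-∈ []       f≈g = ≈-refl
  fold-cong-∈ (x ∷ xs) f≈g =
    ∙-cong (f≈g x (here refl)) (fold-cong-∈ xs (λ y y∈ → f≈g y (there y∈)))

  fold-cong : (xs : List B) {f g : B → Carrier} → (∀ x → f x ≈ g x) → fold xs f ≈ fold xs g
  fold-cong xs f≈g = fold-cong-∈ xs (λ x _ → f≈g x)

  fold-ε : (xs : List B) {f : B → Carrier} → (∀ x → x ∈ xs → f x ≈ ε) → fold xs f ≈ ε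
  fold-ε []       f≈ε = ≈-refl
  fold-ε (x ∷ xs) f≈ε =
    trans (∙-cong (f≈ε x (here refl)) (fold-ε xs (λ y y∈ → f≈ε y (there y∈)))) (identityˡ ε)

  fold-∙ : (xs : List B) (f g : B → Carrier) →
           fold xs (λ x → f x ∙ g x) ≈ fold xs f ∙ fold xs g
  fold-∙ []       f g = sym (identityˡ ε)
  fold-∙ (x ∷ xs) f g = trans (∙-congˡ (fold-∙ xs f g)) (interchange _ _ _ _)

  fold-++ : (xs ys : List B) (f : B → Carrier) → fold (xs ++ ys) f ≈ fold xs f ∙ fold ys f
  fold-++ []       ys f = sym (identityˡ _)
  fold-++ (x ∷ xs) ys f = trans (∙-congˡ (fold-++ xs ys f)) (sym (assoc _ _ _))

  fold-map : (h : B → B′) (xs : List B) (f : B′ → Carrier) →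
             fold (map h xs) f ≡ fold xs (f ∘ h)
  fold-map h []       f = refl
  fold-map h (x ∷ xs) f = ≡.cong (f (h x) ∙_) (fold-map h xs f)

  fold-concatMap : (h : B → List B′) (xs : List B) (f : B′ → Carrier) →
                   fold (concatMap h xs) f ≈ fold xs (λ x → fold (h x) f)
  fold-concatMap h []       f = ≈-refl
  fold-concatMap h (x ∷ xs) f =
    trans (fold-++ (h x) (concatMap h xs) f) (∙-congˡ (fold-concatMap h xs f))

  fold-cartesianProductWith :
    ∀ {d} {D : Set d} (h : B → B′ → D) (xs : List B) (ys : List B′) (f : D → Carrier) →
    fold (cartesianProductWith h xs ys) f ≈ fold xs (λ x → fold ys (λ y → f (h x y)))
  fold-cartesianProductWith h []       ys f = ≈-refl
  fold-cartesianProductWith h (x ∷ xs) ys f =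
    trans (fold-++ (map (h x) ys) _ f)
      (∙-cong (reflexive (fold-map (h x) ys f)) (fold-cartesianProductWith h xs ys f))

  fold-swap : (xs : List B) (ys : List B′) (f : B → B′ → Carrier) →
              fold xs (λ x → fold ys (f x)) ≈ fold ys (λ y → fold xs (λ x → f x y))
  fold-swap []       ys f = sym (fold-ε ys (λ _ _ → ≈-refl))
  fold-swap (x ∷ xs) ys f = trans (∙-congˡ (fold-swap xs ys f)) (sym (fold-∙ ys _ _))

  fold-filter : {P : Pred B p} (P? : Decidable₁ P) (xs : List B) (f : B → Carrier) →
                fold (filter P? xs) f ≈ fold xs (λ x → if ⌊ P? x ⌋ then f x else ε)
  fold-filter P? []       f = ≈-refl
  fold-filter P? (x ∷ xs) f with P? x
  ... | yes _ = ∙-congˡ (fold-filter P? xs f)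
  ... | no _  = trans (fold-filter P? xs f) (sym (identityˡ _))

  fold-upTo-suc : ∀ k (f : ℕ → Carrier) → fold (upTo (suc k)) f ≈ f 0 ∙ fold (upTo k) (f ∘ suc)
  fold-upTo-suc k f = ∙-congˡ (trans
    (reflexive (≡.cong (λ xs → fold xs f) (≡.sym (Listₚ.map-upTo suc k))))
    (reflexive (fold-map suc (upTo k) f)))

  fold-upTo-last : ∀ k (f : ℕ → Carrier) → fold (upTo (suc k)) f ≈ fold (upTo k) f ∙ f k
  fold-upTo-last k f = begin
    fold (upTo (suc k)) f           ≡⟨ ≡.cong (λ xs → fold xs f) (≡.sym (Listₚ.upTo-∷ʳ k)) ⟩
    fold (upTo k ∷ʳ k) f            ≈⟨ fold-++ (upTo k) _ f ⟩
    fold (upTo k) f ∙ (f k ∙ ε)     ≈⟨ ∙-congˡ (identityʳ _) ⟩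
    fold (upTo k) f ∙ f k           ∎

  -- Lets exponentials cut off at different degrees be compared, since the extra terms vanish.
  fold-upTo-extend : ∀ {k l} (f : ℕ → Carrier) → k ℕ.≤ l →
                     (∀ r → k ℕ.≤ r → f r ≈ ε) → fold (upTo l) f ≈ fold (upTo k) f
  fold-upTo-extend {l = l} f z≤n f≈ε = fold-ε (upTo l) (λ r _ → f≈ε r z≤n)
  fold-upTo-extend {suc k} {suc l} f (s≤s k≤l) f≈ε = begin
    fold (upTo (suc l)) f             ≈⟨ fold-upTo-suc l f ⟩
    f 0 ∙ fold (upTo l) (f ∘ suc)     ≈⟨ ∙-congˡ (fold-upTo-extend (f ∘ suc) k≤l (λ r k≤r → f≈ε (suc r) (s≤s k≤r))) ⟩
    f 0 ∙ fold (upTo k) (f ∘ suc)     ≈⟨ fold-upTo-suc k f ⟨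
    fold (upTo (suc k)) f             ∎

  module _ (_≟_ : DecidableEquality B) where

    fold-delta-∉ : (xs : List B) (f : B → Carrier) {d : B} → d ∉ xs →
                   fold xs (λ x → if ⌊ x ≟ d ⌋ then f x else ε) ≈ ε
    fold-delta-∉ xs f {d} d∉ = fold-ε xs vanish
      where
      vanish : ∀ x → x ∈ xs → (if ⌊ x ≟ d ⌋ then f x else ε) ≈ ε
      vanish x x∈ with x ≟ d
      ... | yes refl = contradiction x∈ d∉
      ... | no _     = ≈-refl

    fold-delta-∈ : {xs : List B} (f : B → Carrier) {d : B} → Unique xs → d ∈ xs →
                   fold xs (λ x → if ⌊ x ≟ d ⌋ then f x else ε) ≈ f d
    fold-delta-∈ {xs = x ∷ xs} f {d} (x∉ ∷ u) d∈ with x ≟ d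
    ... | yes refl = trans (∙-congˡ (fold-delta-∉ xs f (λ d∈xs → All.lookup x∉ d∈xs refl))) (identityʳ _)
    ... | no x≢d with d∈
    ...   | here refl  = contradiction refl x≢d
    ...   | there d∈xs = trans (identityˡ _) (fold-delta-∈ f u d∈xs)

module _ (M : CommutativeMonoid c ℓ) {c′ ℓ′} (N : CommutativeMonoid c′ ℓ′) where
  private
    module M = CommutativeMonoid M
    module N = CommutativeMonoid N

  -- Serves multiplication by a fixed element, multiplication by a natural number, and the
  -- evaluation of polynomials alike.
  fold-homo : (h : M.Carrier → N.Carrier) → h M.ε N.≈ N.ε →
              (∀ x y → h (x M.∙ y) N.≈ h x N.∙ h y) →
              (xs : List B) (f : B → M.Carrier) →
              h (ListFold.fold M xs f) N.≈ ListFold.fold N xs (h ∘ f)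
  fold-homo h h-ε h-∙ []       f = h-ε
  fold-homo h h-ε h-∙ (x ∷ xs) f =
    N.trans (h-∙ (f x) _) (N.∙-congˡ (fold-homo h h-ε h-∙ xs f))

-- Convolution sums over pairs with a given sum

module Convolution (M : CommutativeMonoid c ℓ) where
  open CommutativeMonoid M renaming (refl to ≈-refl)
  open SetoidReasoning setoid
  open ListFold M

  -- Opaque, so that unification can recover f from convℕ k f and conv i f.
  opaque
    convℕ : ℕ → (ℕ → ℕ → Carrier) → Carrier
    convℕ k f = fold (upTo (suc k)) (λ x → f x (k ∸ x))

    conv : Index m → (Index m → Index m → Carrier) → Carrier
    conv i f = fold (below i) (λ x → f x (i ∸ᵢ x))

    -- The equation x + y = k is handed to the caller because later steps depend on it: the Leibniz
    -- rule adds the weights p and q, and the Cauchy product bounds the length of an inner sum.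
    convℕ-cong : ∀ k {f g : ℕ → ℕ → Carrier} →
                 (∀ x y → x ℕ.+ y ≡ k → f x y ≈ g x y) → convℕ k f ≈ convℕ k g
    convℕ-cong k f≈g = fold-cong-∈ (upTo (suc k)) λ x x∈ →
      f≈g x (k ∸ x) (ℕₚ.m+[n∸m]≡n (ℕₚ.≤-pred (∈-upTo⁻ x∈)))

    conv-cong : (i : Index m) {f g : Index m → Index m → Carrier} →
                (∀ x y → f x y ≈ g x y) → conv i f ≈ conv i g
    conv-cong i f≈g = fold-cong (below i) (λ x → f≈g x (i ∸ᵢ x))

    convℕ-∙ : ∀ k (f g : ℕ → ℕ → Carrier) →
              convℕ k (λ x y → f x y ∙ g x y) ≈ convℕ k f ∙ convℕ k g
    convℕ-∙ k f g = fold-∙ (upTo (suc k)) _ _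

    conv-∷ : ∀ k (ks : Index m) (f : Index (suc m) → Index (suc m) → Carrier) →
             conv (k ∷ ks) f ≈ convℕ k (λ x y → conv ks (λ xs ys → f (x ∷ xs) (y ∷ ys)))
    conv-∷ k ks f = fold-cartesianProductWith _∷_ (upTo (suc k)) (below ks) _

    convℕ-head : ∀ k (f : ℕ → ℕ → Carrier) →
                 convℕ (suc k) f ≈ f 0 (suc k) ∙ convℕ k (λ x y → f (suc x) y)
    convℕ-head k f = fold-upTo-suc (suc k) (λ x → f x (suc k ∸ x))

    convℕ-last : ∀ k (f : ℕ → ℕ → Carrier) →
                 convℕ (suc k) f ≈ convℕ k (λ x y → f x (suc y)) ∙ f (suc k) 0
    convℕ-last k f = begin
      convℕ (suc k) f
        ≈⟨ fold-upTo-last (suc k) (λ x → f x (suc k ∸ x)) ⟩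
      fold (upTo (suc k)) (λ x → f x (suc k ∸ x)) ∙ f (suc k) (k ∸ k)
        -- Subtraction is truncated, so suc k ∸ x is suc (k ∸ x) only for x ≤ k; membership in the
        -- range supplies this bound.
        ≈⟨ ∙-cong (fold-cong-∈ (upTo (suc k)) λ x x∈ →
             reflexive (≡.cong (f x) (ℕₚ.+-∸-assoc 1 (ℕₚ.≤-pred (∈-upTo⁻ x∈)))))
           (reflexive (≡.cong (f (suc k)) (ℕₚ.n∸n≡0 k))) ⟩
      convℕ k (λ x y → f x (suc y)) ∙ f (suc k) 0 ∎

    conv-fold : (i : Index m) (f : Index m → Index m → Carrier) →
                conv i f ≡ fold (below i) (λ x → f x (i ∸ᵢ x))
    conv-fold i f = refl

    convℕ-fold : ∀ k (f : ℕ → ℕ → Carrier) → convℕ k f ≡ fold (upTo (suc k)) (λ x → f x (k ∸ x))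
    convℕ-fold k f = refl

    convℕ-zero : (f : ℕ → ℕ → Carrier) → convℕ 0 f ≈ f 0 0
    convℕ-zero f = identityʳ _

    conv-[] : (f : Index 0 → Index 0 → Carrier) → conv [] f ≈ f [] []
    conv-[] f = identityʳ _

    conv-convℕ-swap : (ks : Index m) (k : ℕ) (f : Index m → Index m → ℕ → ℕ → Carrier) →
                      conv ks (λ xs ys → convℕ k (f xs ys)) ≈
                      convℕ k (λ x y → conv ks (λ xs ys → f xs ys x y))
    conv-convℕ-swap ks k f = fold-swap (below ks) (upTo (suc k)) _

  -- Splitting off the first term on one side and the last on the other avoids reversing the list of
  -- summation indices.
  convℕ-comm : ∀ k (f : ℕ → ℕ → Carrier) → convℕ k f ≈ convℕ k (λ x y → f y x)
  convℕ-comm zero    f = trans (convℕ-zero f) (sym (convℕ-zero _))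
  convℕ-comm (suc k) f = begin
    convℕ (suc k) f                               ≈⟨ convℕ-head k f ⟩
    f 0 (suc k) ∙ convℕ k (λ x y → f (suc x) y)   ≈⟨ ∙-congˡ (convℕ-comm k (λ x y → f (suc x) y)) ⟩
    f 0 (suc k) ∙ convℕ k (λ x y → f (suc y) x)   ≈⟨ comm _ _ ⟩
    convℕ k (λ x y → f (suc y) x) ∙ f 0 (suc k)   ≈⟨ convℕ-last k (λ x y → f y x) ⟨
    convℕ (suc k) (λ x y → f y x)                 ∎

  conv-comm : (i : Index m) (f : Index m → Index m → Carrier) → conv i f ≈ conv i (λ x y → f y x)
  conv-comm []       f = trans (conv-[] f) (sym (conv-[] _))
  conv-comm (k ∷ ks) f = begin
    conv (k ∷ ks) f
      ≈⟨ conv-∷ k ks f ⟩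
    convℕ k (λ x y → conv ks (λ xs ys → f (x ∷ xs) (y ∷ ys)))
      ≈⟨ convℕ-cong k (λ x y _ → conv-comm ks (λ xs ys → f (x ∷ xs) (y ∷ ys))) ⟩
    convℕ k (λ x y → conv ks (λ xs ys → f (x ∷ ys) (y ∷ xs)))
      ≈⟨ convℕ-comm k _ ⟩
    convℕ k (λ x y → conv ks (λ xs ys → f (y ∷ ys) (x ∷ xs)))
      ≈⟨ conv-∷ k ks (λ x y → f y x) ⟨
    conv (k ∷ ks) (λ x y → f y x) ∎

  -- Both sides run over x + y + z = k. The terms with x = 0 are split off, and the remaining ones
  -- are the claim at k - 1 for f shifted in its first argument.
  convℕ-assoc : ∀ k (f : ℕ → ℕ → ℕ → Carrier) →
                convℕ k (λ x s → convℕ s (λ y z → f x y z)) ≈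
                convℕ k (λ s z → convℕ s (λ x y → f x y z))
  convℕ-assoc zero    f =
    trans (trans (convℕ-zero _) (convℕ-zero _)) (sym (trans (convℕ-zero _) (convℕ-zero _)))
  convℕ-assoc (suc k) f = begin
    convℕ (suc k) (λ x s → convℕ s (λ y z → f x y z))
      ≈⟨ convℕ-head k _ ⟩
    convℕ (suc k) (f 0) ∙ convℕ k (λ x s → convℕ s (λ y z → f (suc x) y z))
      ≈⟨ ∙-cong (convℕ-head k (f 0)) (convℕ-assoc k (f ∘ suc)) ⟩
    (f 0 0 (suc k) ∙ convℕ k (λ s z → f 0 (suc s) z)) ∙
      convℕ k (λ s z → convℕ s (λ x y → f (suc x) y z))
      ≈⟨ assoc _ _ _ ⟩
    f 0 0 (suc k) ∙ (convℕ k (λ s z → f 0 (suc s) z) ∙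
      convℕ k (λ s z → convℕ s (λ x y → f (suc x) y z)))
      ≈⟨ ∙-cong (sym (convℕ-zero _)) (sym (convℕ-∙ k _ _)) ⟩
    convℕ 0 (λ x y → f x y (suc k)) ∙
      convℕ k (λ s z → f 0 (suc s) z ∙ convℕ s (λ x y → f (suc x) y z))
      ≈⟨ ∙-congˡ (convℕ-cong k (λ s z _ → sym (convℕ-head s (λ x y → f x y z)))) ⟩
    convℕ 0 (λ x y → f x y (suc k)) ∙ convℕ k (λ s z → convℕ (suc s) (λ x y → f x y z))
      ≈⟨ convℕ-head k _ ⟨
    convℕ (suc k) (λ s z → convℕ s (λ x y → f x y z)) ∎


  -- One row at a time: the two exchanges of summation bring the sums over the first row outside,
  -- where the one-dimensional law applies, and the induction hypothesis treats the other rows.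
  conv-assoc : (i : Index m) (f : Index m → Index m → Index m → Carrier) →
               conv i (λ x s → conv s (λ y z → f x y z)) ≈
               conv i (λ s z → conv s (λ x y → f x y z))
  conv-assoc []       f =
    trans (trans (conv-[] _) (conv-[] _)) (sym (trans (conv-[] _) (conv-[] _)))
  conv-assoc (k ∷ ks) f = begin
    conv (k ∷ ks) (λ x s → conv s (λ y z → f x y z))
      ≈⟨ conv-∷ k ks _ ⟩
    convℕ k (λ x s → conv ks (λ xs ss → conv (s ∷ ss) (λ y z → f (x ∷ xs) y z)))
      ≈⟨ convℕ-cong k (λ x s _ → conv-cong ks λ xs ss → conv-∷ s ss _) ⟩
    convℕ k (λ x s → conv ks (λ xs ss → convℕ s λ y z → conv ss λ ys zs → f (x ∷ xs) (y ∷ ys) (z ∷ zs)))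
      ≈⟨ convℕ-cong k (λ x s _ → conv-convℕ-swap ks s _) ⟩
    convℕ k (λ x s → convℕ s λ y z → conv ks (λ xs ss → conv ss λ ys zs → f (x ∷ xs) (y ∷ ys) (z ∷ zs)))
      ≈⟨ convℕ-cong k (λ x s _ → convℕ-cong s λ y z _ → conv-assoc ks λ xs ys zs → f (x ∷ xs) (y ∷ ys) (z ∷ zs)) ⟩
    convℕ k (λ x s → convℕ s λ y z → conv ks (λ ss zs → conv ss λ xs ys → f (x ∷ xs) (y ∷ ys) (z ∷ zs)))
      ≈⟨ convℕ-assoc k (λ x y z → conv ks (λ ss zs → conv ss λ xs ys → f (x ∷ xs) (y ∷ ys) (z ∷ zs))) ⟩
    convℕ k (λ s z → convℕ s λ x y → conv ks (λ ss zs → conv ss λ xs ys → f (x ∷ xs) (y ∷ ys) (z ∷ zs)))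
      ≈⟨ convℕ-cong k (λ s z _ → sym (conv-convℕ-swap ks s _)) ⟩
    convℕ k (λ s z → conv ks (λ ss zs → convℕ s λ x y → conv ss λ xs ys → f (x ∷ xs) (y ∷ ys) (z ∷ zs)))
      ≈⟨ convℕ-cong k (λ s z _ → conv-cong ks λ ss zs → sym (conv-∷ s ss _)) ⟩
    convℕ k (λ s z → conv ks (λ ss zs → conv (s ∷ ss) (λ x y → f x y (z ∷ zs))))
      ≈⟨ conv-∷ k ks _ ⟨
    conv (k ∷ ks) (λ s z → conv s (λ x y → f x y z)) ∎

-- Sums in a ring and arithmetic of multi-indices

nonzeroBelow-unique : (k : Index m) → Unique (nonzeroBelow k)
nonzeroBelow-unique k = Enumeration.increasing⇒unique (Enumeration.nonzeroBelow-increasing k)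

nonzeroBelow-nonzero : (k : Index m) → All (_≢ 0ᵢ) (nonzeroBelow k)
nonzeroBelow-nonzero k = Allₚ.all-filter (λ e → ¬? (e ≟ᵢ 0ᵢ)) (below k)

module RingSums (R : CommutativeRing c ℓ) where
  open CommutativeRing R hiding (zero) renaming (refl to ≈-refl)
  open BigOperators R
  open Convolution +-commutativeMonoid
  open SemiringMult semiring using (_×_)
  open CommutativeMonoidMult +-commutativeMonoid using (×-distrib-+)

  private
    +-M = +-commutativeMonoid

  ∑-*ʳ : (xs : List B) (f : B → Carrier) (y : Carrier) → (∑ xs f) * y ≈ ∑ xs (λ x → f x * y)
  ∑-*ʳ xs f y = fold-homo +-M +-M (_* y) (zeroˡ y) (λ a b → distribʳ y a b) xs f

  ∑-*ˡ : (xs : List B) (f : B → Carrier) (y : Carrier) → y * (∑ xs f) ≈ ∑ xs (λ x → y * f x)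
  ∑-*ˡ xs f y = fold-homo +-M +-M (y *_) (zeroʳ y) (λ a b → distribˡ y a b) xs f

  opaque
    unfolding conv convℕ

    conv-*ʳ : (i : Index m) (f : Index m → Index m → Carrier) (y : Carrier) →
              conv i f * y ≈ conv i (λ k l → f k l * y)
    conv-*ʳ i f y = ∑-*ʳ (below i) _ y

    conv-*ˡ : (i : Index m) (f : Index m → Index m → Carrier) (y : Carrier) →
              y * conv i f ≈ conv i (λ k l → y * f k l)
    conv-*ˡ i f y = ∑-*ˡ (below i) _ y

    convℕ-*ˡ : ∀ k (f : ℕ → ℕ → Carrier) (y : Carrier) →
               y * convℕ k f ≈ convℕ k (λ p q → y * f p q)
    convℕ-*ˡ k f y = ∑-*ˡ (upTo (suc k)) _ y

    convℕ-× : ∀ k (f : ℕ → ℕ → Carrier) r → r × convℕ k f ≈ convℕ k (λ p q → r × f p q)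
    convℕ-× k f r = fold-homo +-M +-M (r ×_) (×-zeroʳ r) (λ a b → ×-distrib-+ a b r) (upTo (suc k)) _
      where
      ×-zeroʳ : ∀ r → r × 0# ≈ 0#
      ×-zeroʳ zero    = ≈-refl
      ×-zeroʳ (suc r) = trans (+-identityˡ _) (×-zeroʳ r)

∣∣ᵢ-+ : (x y : Index m) → ∣ x +ᵢ y ∣ᵢ ≡ ∣ x ∣ᵢ ℕ.+ ∣ y ∣ᵢ
∣∣ᵢ-+ []       []       = refl
∣∣ᵢ-+ (x ∷ xs) (y ∷ ys) =
  ≡.trans (≡.cong (x ℕ.+ y ℕ.+_) (∣∣ᵢ-+ xs ys)) (interchange x y ∣ xs ∣ᵢ ∣ ys ∣ᵢ)
  where open CommutativeSemigroupProperties ℕₚ.+-commutativeSemigroup using (interchange)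

∣∣ᵢ-∸ : {k i : Index m} → k ≤ᵢ i → ∣ k ∣ᵢ ℕ.+ ∣ i ∸ᵢ k ∣ᵢ ≡ ∣ i ∣ᵢ
∣∣ᵢ-∸ {k = k} k≤i = ≡.trans (≡.sym (∣∣ᵢ-+ k _)) (≡.cong ∣_∣ᵢ (Enumeration.+-∸ᵢ k≤i))

∣∣ᵢ≡0 : (k : Index m) → ∣ k ∣ᵢ ≡ 0 → k ≡ 0ᵢ
∣∣ᵢ≡0 []          _  = refl
∣∣ᵢ≡0 (zero ∷ ks) eq = ≡.cong (0 ∷_) (∣∣ᵢ≡0 ks eq)

0ᵢ≤ : (k : Index m) → 0ᵢ ≤ᵢ k
0ᵢ≤ []       = []
0ᵢ≤ (_ ∷ ks) = z≤n ∷ 0ᵢ≤ ks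

∸ᵢ-0ᵢ : (k : Index m) → k ∸ᵢ 0ᵢ ≡ k
∸ᵢ-0ᵢ []       = refl
∸ᵢ-0ᵢ (k ∷ ks) = ≡.cong (k ∷_) (∸ᵢ-0ᵢ ks)

below-unique : (i : Index m) → Unique (below i)
below-unique i = Enumeration.increasing⇒unique (Enumeration.below-increasing i)

-- Reciprocals of natural numbers

module Reciprocals (R : CommutativeRing c ℓ) where
  open CommutativeRing R hiding (zero) renaming (refl to ≈-refl)
  open SemiringMult semiring using (_×_; ×-congʳ; ×-assoc-*; ×1-homo-*)
  open SetoidReasoning setoid

  -- Formal series take `recip` as an arbitrary function, so its defining law is a separate
  -- hypothesis, with the value at 0 left free. In this form it can be transported to polynomial
  -- rings, which are not fields.
  IsReciprocal : (ℕ → Carrier) → Set ℓ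
  IsReciprocal recip = ∀ n .{{_ : NonZero n}} → recip n * (n × 1#) ≈ 1#

  module _ {recip : ℕ → Carrier} (recip-inverse : IsReciprocal recip) where
    open CommutativeSemigroupProperties *-commutativeSemigroup using (interchange)

    recip-× : ∀ n .{{_ : NonZero n}} x → recip n * (n × x) ≈ x
    recip-× n x = begin
      recip n * (n × x)           ≈⟨ *-congˡ (×-congʳ n (*-identityˡ x)) ⟨
      recip n * (n × (1# * x))    ≈⟨ *-congˡ (×-assoc-* n 1# x) ⟨
      recip n * ((n × 1#) * x)    ≈⟨ *-assoc _ _ _ ⟨
      recip n * (n × 1#) * x      ≈⟨ *-congʳ (recip-inverse n) ⟩
      1# * x                      ≈⟨ *-identityˡ x ⟩
      x                           ∎

    ×-cancelˡ : ∀ n .{{_ : NonZero n}} {x y} → n × x ≈ n × y → x ≈ y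
    ×-cancelˡ n {x} {y} eq = trans (sym (recip-× n x)) (trans (*-congˡ eq) (recip-× n y))

    recip-unique : ∀ n .{{_ : NonZero n}} {x} → x * (n × 1#) ≈ 1# → recip n ≈ x
    recip-unique n {x} eq = begin
      recip n                     ≈⟨ *-identityˡ _ ⟨
      1# * recip n                ≈⟨ *-congʳ eq ⟨
      x * (n × 1#) * recip n      ≈⟨ *-assoc _ _ _ ⟩
      x * ((n × 1#) * recip n)    ≈⟨ *-congˡ (trans (*-comm _ _) (recip-inverse n)) ⟩
      x * 1#                      ≈⟨ *-identityʳ x ⟩
      x                           ∎

    recip-1 : recip 1 ≈ 1#
    recip-1 = recip-unique 1 (trans (*-identityˡ _) (+-identityʳ 1#))

    recip-* : ∀ k l .{{_ : NonZero k}} .{{_ : NonZero l}} →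
              recip (k ℕ.* l) ≈ recip k * recip l
    recip-* k l = recip-unique (k ℕ.* l) {{ℕₚ.m*n≢0 k l}} (begin
      recip k * recip l * ((k ℕ.* l) × 1#)            ≈⟨ *-congˡ (×1-homo-* k l) ⟩
      recip k * recip l * ((k × 1#) * (l × 1#))       ≈⟨ interchange _ _ _ _ ⟩
      recip k * (k × 1#) * (recip l * (l × 1#))       ≈⟨ *-cong (recip-inverse k) (recip-inverse l) ⟩
      1# * 1#                                         ≈⟨ *-identityˡ 1# ⟩
      1#                                              ∎)

    recip-! : ∀ n → suc n × recip (suc n !) ≈ recip (n !)
    recip-! n = begin
      suc n × recip (suc n !)                   ≈⟨ ×-congʳ (suc n) (recip-* (suc n) (n !) {{_}} {{ℕₚ._!≢0 n}}) ⟩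
      suc n × (recip (suc n) * recip (n !))     ≈⟨ ×-comm-* (suc n) _ _ ⟨
      recip (suc n) * (suc n × recip (n !))     ≈⟨ recip-× (suc n) _ ⟩
      recip (n !)                               ∎
      where open SemiringMult semiring using (×-comm-*)

-- Formal power series and divided powers

module FormalExponential (R : CommutativeRing c ℓ) (recip : ℕ → CommutativeRing.Carrier R)
                         (recip-inverse : Reciprocals.IsReciprocal R recip) (m : ℕ) where
  open CommutativeRing R hiding (zero) renaming (refl to ≈-refl)
  open BigOperators R
  open FormalSeries R recip m
  open ListFold +-commutativeMonoid
  open Convolution +-commutativeMonoid
  open RingSums R
  open Reciprocals R
  open SemiringMult semiring using (_×_; ×-congʳ; ×-congˡ; ×-assoc-*; ×-homo-+)
  open SetoidReasoning setoid
  private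
    module *CS = CommutativeSemigroupProperties *-commutativeSemigroup

  infix  4 _≈ₛ_
  infixl 6 _+ₛ_

  _≈ₛ_ : Series → Series → Set ℓ
  F ≈ₛ G = ∀ i → F i ≈ G i

  _+ₛ_ : Series → Series → Series
  (F +ₛ G) i = F i + G i

  monomial : Carrier → Index m → Series
  monomial a e k = if ⌊ k ≟ᵢ e ⌋ then a else 0#

  *ₛ-conv : ∀ F G i → (F *ₛ G) i ≡ conv i (λ k l → F k * G l)
  *ₛ-conv F G i = ≡.sym (conv-fold i (λ k l → F k * G l))

  *ₛ-cong : ∀ {F F′ G G′} → F ≈ₛ F′ → G ≈ₛ G′ → F *ₛ G ≈ₛ F′ *ₛ G′
  *ₛ-cong F≈ G≈ i = fold-cong (below i) (λ k → *-cong (F≈ k) (G≈ (i ∸ᵢ k)))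

  *ₛ-comm : ∀ F G → F *ₛ G ≈ₛ G *ₛ F
  *ₛ-comm F G i = begin
    (F *ₛ G) i                   ≡⟨ *ₛ-conv F G i ⟩
    conv i (λ k l → F k * G l)   ≈⟨ conv-comm i _ ⟩
    conv i (λ k l → F l * G k)   ≈⟨ conv-cong i (λ k l → *-comm (F l) (G k)) ⟩
    conv i (λ k l → G k * F l)   ≡⟨ *ₛ-conv G F i ⟨
    (G *ₛ F) i                   ∎

  *ₛ-assoc : ∀ F G H → (F *ₛ G) *ₛ H ≈ₛ F *ₛ (G *ₛ H)
  *ₛ-assoc F G H i = begin
    ((F *ₛ G) *ₛ H) i
      ≡⟨ *ₛ-conv (F *ₛ G) H i ⟩
    conv i (λ s z → (F *ₛ G) s * H z)
      ≈⟨ conv-cong i (λ s z → trans (*-congʳ (reflexive (*ₛ-conv F G s)))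
           (trans (conv-*ʳ s _ (H z)) (conv-cong s (λ x y → *-assoc (F x) (G y) (H z))))) ⟩
    conv i (λ s z → conv s (λ x y → F x * (G y * H z)))
      ≈⟨ conv-assoc i (λ x y z → F x * (G y * H z)) ⟨
    conv i (λ x s → conv s (λ y z → F x * (G y * H z)))
      ≈⟨ conv-cong i (λ x s → trans (*-congˡ (reflexive (*ₛ-conv G H s))) (conv-*ˡ s _ (F x))) ⟨
    conv i (λ x s → F x * (G *ₛ H) s)
      ≡⟨ *ₛ-conv F (G *ₛ H) i ⟨
    (F *ₛ (G *ₛ H)) i ∎

  *ₛ-distribʳ : ∀ H F G → (F +ₛ G) *ₛ H ≈ₛ F *ₛ H +ₛ G *ₛ H
  *ₛ-distribʳ H F G i =
    trans (fold-cong (below i) (λ k → distribʳ (H (i ∸ᵢ k)) (F k) (G k))) (fold-∙ (below i) _ _)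

  if-*ʳ : ∀ {p} {P : Set p} (P? : Dec P) (a b : Carrier) →
          (if ⌊ P? ⌋ then a else 0#) * b ≈ (if ⌊ P? ⌋ then a * b else 0#)
  if-*ʳ (yes _) a b = ≈-refl
  if-*ʳ (no _)  a b = zeroˡ b

  -- Multiplication by a t^e is a shift by e. The guard is essential: when e exceeds i in some row,
  -- truncated subtraction would still return a coefficient of F.
  monomial-*ₛ : ∀ a e F i → (monomial a e *ₛ F) i ≈ (if ⌊ e ≤ᵢ? i ⌋ then a * F (i ∸ᵢ e) else 0#)
  monomial-*ₛ a e F i = trans (fold-cong (below i) (λ k → if-*ʳ (k ≟ᵢ e) a (F (i ∸ᵢ k)))) go
    where
    go : (∑[ k ∈ below i ] (if ⌊ k ≟ᵢ e ⌋ then a * F (i ∸ᵢ k) else 0#)) ≈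
         (if ⌊ e ≤ᵢ? i ⌋ then a * F (i ∸ᵢ e) else 0#)
    go with e ≤ᵢ? i
    ... | yes e≤i = fold-delta-∈ _≟ᵢ_ _ (below-unique i) (Enumeration.∈-below⁺ e≤i)
    ... | no  e≰i = fold-delta-∉ _≟ᵢ_ (below i) _ (λ e∈ → e≰i (Enumeration.∈-below⁻ e i e∈))

  *ₛ-identityˡ : ∀ F → 1ₛ *ₛ F ≈ₛ F
  -- The unit series is by definition `monomial 1# 0ᵢ`, so this is a shift by zero.
  *ₛ-identityˡ F i with 0ᵢ ≤ᵢ? i | monomial-*ₛ 1# 0ᵢ F i
  ... | yes _  | eq = trans eq (trans (*-identityˡ _) (reflexive (≡.cong F (∸ᵢ-0ᵢ i))))
  ... | no 0≰i | _  = contradiction (0ᵢ≤ i) 0≰i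

  *ₛ-scaleʳ : ∀ a F G i → (F *ₛ (λ k → a * G k)) i ≈ a * (F *ₛ G) i
  *ₛ-scaleʳ a F G i = trans
    (fold-cong (below i) (λ k → *CS.x∙yz≈y∙xz (F k) a (G (i ∸ᵢ k))))
    (sym (∑-*ˡ (below i) _ a))

  *ₛ-convℕʳ : ∀ F r (G : ℕ → ℕ → Series) i →
              (F *ₛ (λ k → convℕ r (λ p q → G p q k))) i ≈ convℕ r (λ p q → (F *ₛ G p q) i)
  *ₛ-convℕʳ F r G i = begin
    (F *ₛ (λ k → convℕ r (λ p q → G p q k))) i
      ≡⟨ *ₛ-conv F _ i ⟩
    conv i (λ k l → F k * convℕ r (λ p q → G p q l))
      ≈⟨ conv-cong i (λ k l → convℕ-*ˡ r _ (F k)) ⟩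
    conv i (λ k l → convℕ r (λ p q → F k * G p q l))
      ≈⟨ conv-convℕ-swap i r _ ⟩
    convℕ r (λ p q → conv i (λ k l → F k * G p q l))
      ≈⟨ convℕ-cong r (λ p q _ → reflexive (*ₛ-conv F (G p q) i)) ⟨
    convℕ r (λ p q → (F *ₛ G p q) i) ∎

  dividedPower : ℕ → Series → Series
  dividedPower r F i = recip (r !) * (F ^ₛ r) i

  private
    D = dividedPower

  -- Apart from the value at r = 0, this recursion is all that the binomial identity needs to know
  -- about the factorials; binomial coefficients never appear.
  dividedPower-suc : ∀ r F i → suc r × D (suc r) F i ≈ (F *ₛ D r F) i
  dividedPower-suc r F i = begin
    suc r × (recip (suc r !) * (F ^ₛ suc r) i)     ≈⟨ ×-assoc-* (suc r) _ _ ⟨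
    (suc r × recip (suc r !)) * (F ^ₛ suc r) i     ≈⟨ *-congʳ (recip-! recip-inverse r) ⟩
    recip (r !) * (F *ₛ F ^ₛ r) i                  ≈⟨ *ₛ-scaleʳ (recip (r !)) F (F ^ₛ r) i ⟨
    (F *ₛ D r F) i                                 ∎

  ×-*ₛ : ∀ r F G i → ((λ k → r × F k) *ₛ G) i ≈ r × (F *ₛ G) i
  ×-*ₛ r F G i = begin
    ((λ k → r × F k) *ₛ G) i   ≈⟨ fold-cong (below i) (λ k → scale (F k) (G (i ∸ᵢ k))) ⟩
    (∑[ k ∈ below i ] (r × 1#) * (F k * G (i ∸ᵢ k)))   ≈⟨ ∑-*ˡ (below i) _ _ ⟨
    (r × 1#) * (F *ₛ G) i      ≈⟨ ×-assoc-* r 1# _ ⟩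
    r × (1# * (F *ₛ G) i)      ≈⟨ ×-congʳ r (*-identityˡ _) ⟩
    r × (F *ₛ G) i             ∎
    where
    scale : ∀ x y → (r × x) * y ≈ (r × 1#) * (x * y)
    scale x y = trans (×-assoc-* r x y)
      (sym (trans (×-assoc-* r 1# _) (×-congʳ r (*-identityˡ _))))

  -- Multiplied by r + 1, the identity for r + 1 becomes the Leibniz rule for
  -- the product (F + G) D_r (F + G).
  dividedPower-+ : ∀ r F G i → D r (F +ₛ G) i ≈ convℕ r (λ p q → (D p F *ₛ D q G) i)
  dividedPower-+ zero F G i = begin
    recip 1 * 1ₛ i                       ≈⟨ *-congˡ (*ₛ-identityˡ 1ₛ i) ⟨
    recip 1 * (1ₛ *ₛ 1ₛ) i               ≈⟨ *ₛ-scaleʳ (recip 1) 1ₛ 1ₛ i ⟨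
    (1ₛ *ₛ D 0 G) i                      ≈⟨ *ₛ-cong {G = D 0 G} (λ k → trans (*-congʳ (recip-1 recip-inverse)) (*-identityˡ (1ₛ k))) (λ _ → ≈-refl) i ⟨
    (D 0 F *ₛ D 0 G) i                   ≈⟨ convℕ-zero _ ⟨
    convℕ 0 (λ p q → (D p F *ₛ D q G) i) ∎
  dividedPower-+ (suc r) F G i = ×-cancelˡ recip-inverse (suc r) (begin
    suc r × D (suc r) (F +ₛ G) i
      ≈⟨ dividedPower-suc r (F +ₛ G) i ⟩
    ((F +ₛ G) *ₛ D r (F +ₛ G)) i
      ≈⟨ *ₛ-cong {F +ₛ G} (λ _ → ≈-refl) (dividedPower-+ r F G) i ⟩
    ((F +ₛ G) *ₛ C) i
      ≈⟨ *ₛ-distribʳ C F G i ⟩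
    (F *ₛ C) i + (G *ₛ C) i
      ≈⟨ +-cong (*ₛ-convℕʳ F r (λ p q → D p F *ₛ D q G) i) (*ₛ-convℕʳ G r (λ p q → D p F *ₛ D q G) i) ⟩
    convℕ r (λ p q → (F *ₛ (D p F *ₛ D q G)) i) + convℕ r (λ p q → (G *ₛ (D p F *ₛ D q G)) i)
      ≈⟨ +-cong (convℕ-cong r (λ p q _ → left p q)) (convℕ-cong r (λ p q _ → right p q)) ⟩
    convℕ r (λ p q → suc p × X (suc p) q) + convℕ r (λ p q → suc q × X p (suc q))
      -- Both sums are extended to p + q = suc r. The added terms, p = 0 in one and q = 0 in the
      -- other, carry the factor zero, and the two weights can then be added.
      ≈⟨ +-cong (trans (convℕ-head r (λ p q → p × X p q)) (+-identityˡ _))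
                (trans (convℕ-last r (λ p q → q × X p q)) (+-identityʳ _)) ⟨
    convℕ (suc r) (λ p q → p × X p q) + convℕ (suc r) (λ p q → q × X p q)
      ≈⟨ convℕ-∙ (suc r) _ _ ⟨
    convℕ (suc r) (λ p q → p × X p q + q × X p q)
      ≈⟨ convℕ-cong (suc r) (λ p q p+q≡ →
           trans (sym (×-homo-+ (X p q) p q)) (×-congˡ p+q≡)) ⟩
    convℕ (suc r) (λ p q → suc r × X p q)
      ≈⟨ convℕ-× (suc r) _ (suc r) ⟨
    suc r × convℕ (suc r) X ∎)
    where
    X : ℕ → ℕ → Carrier
    X p q = (D p F *ₛ D q G) i

    C : Series
    C k = convℕ r (λ p q → (D p F *ₛ D q G) k)

    left : ∀ p q → (F *ₛ (D p F *ₛ D q G)) i ≈ suc p × X (suc p) q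
    left p q = begin
      (F *ₛ (D p F *ₛ D q G)) i                  ≈⟨ *ₛ-assoc F (D p F) (D q G) i ⟨
      ((F *ₛ D p F) *ₛ D q G) i                  ≈⟨ *ₛ-cong {G = D q G} (dividedPower-suc p F) (λ _ → ≈-refl) i ⟨
      ((λ k → suc p × D (suc p) F k) *ₛ D q G) i ≈⟨ ×-*ₛ (suc p) (D (suc p) F) (D q G) i ⟩
      suc p × X (suc p) q                        ∎

    right : ∀ p q → (G *ₛ (D p F *ₛ D q G)) i ≈ suc q × X p (suc q)
    right p q = begin
      (G *ₛ (D p F *ₛ D q G)) i                  ≈⟨ *ₛ-cong {G} (λ _ → ≈-refl) (*ₛ-comm (D p F) (D q G)) i ⟩
      (G *ₛ (D q G *ₛ D p F)) i                  ≈⟨ *ₛ-assoc G (D q G) (D p F) i ⟨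
      ((G *ₛ D q G) *ₛ D p F) i                  ≈⟨ *ₛ-cong {G = D p F} (dividedPower-suc q G) (λ _ → ≈-refl) i ⟨
      ((λ k → suc q × D (suc q) G k) *ₛ D p F) i ≈⟨ ×-*ₛ (suc q) (D (suc q) G) (D p F) i ⟩
      suc q × (D (suc q) G *ₛ D p F) i           ≈⟨ ×-congʳ (suc q) (*ₛ-comm (D (suc q) G) (D p F) i) ⟩
      suc q × X p (suc q)                        ∎

-- Multiplicities and distinct columns

multiplicity-replicate-same : ∀ r {e : Index m} {μ} → e ∉ μ → multiplicity e (List.replicate r e ++ μ) ≡ r
multiplicity-replicate-same zero    {e} {μ} e∉ =
  ≡.cong List.length (Listₚ.filter-none (e ≟ᵢ_) (All.tabulate λ { d∈ refl → e∉ d∈ }))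
multiplicity-replicate-same (suc r) {e} e∉ =
  ≡.trans (≡.cong List.length (Listₚ.filter-accept (e ≟ᵢ_) refl))
          (≡.cong suc (multiplicity-replicate-same r e∉))

multiplicity-replicate-other : ∀ r {d e : Index m} {μ} → d ≢ e →
  multiplicity d (List.replicate r e ++ μ) ≡ multiplicity d μ
multiplicity-replicate-other zero            d≢e = refl
multiplicity-replicate-other (suc r) {d} {e} d≢e =
  ≡.trans (≡.cong List.length (Listₚ.filter-reject (d ≟ᵢ_) d≢e)) (multiplicity-replicate-other r d≢e)

distinctColumns⊆ : {d : Index m} (μ : Columns m) → d ∈ distinctColumns μ → d ∈ μ
distinctColumns⊆ μ = ∈-deduplicate⁻ _≟ᵢ_ μ

-- Deduplication keeps the leading e and filters e out of the deduplicated remainder, which contains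
-- at most one further copy of e; as e is not in μ, the filter removes nothing else.
distinctColumns-replicate : ∀ r {e : Index m} {μ} → e ∉ μ →
  distinctColumns (List.replicate (suc r) e ++ μ) ≡ e ∷ distinctColumns μ
distinctColumns-replicate r {e} {μ} e∉ = ≡.cong (e ∷_) (go r)
  where
  others : filter (¬? ∘ (e ≟ᵢ_)) (distinctColumns μ) ≡ distinctColumns μ
  others = Listₚ.filter-all _ (All.tabulate λ { d∈ refl → e∉ (distinctColumns⊆ μ d∈) })

  go : ∀ r → filter (¬? ∘ (e ≟ᵢ_)) (distinctColumns (List.replicate r e ++ μ)) ≡ distinctColumns μ
  go zero    = others
  go (suc r) = ≡.trans
    (≡.cong (filter (¬? ∘ (e ≟ᵢ_))) (distinctColumns-replicate r e∉))
    (≡.trans (Listₚ.filter-reject (¬? ∘ (e ≟ᵢ_)) (λ e≢e → e≢e refl)) others)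

module DistinctColumns (M : CommutativeMonoid c ℓ) where
  open CommutativeMonoid M renaming (refl to ≈-refl)
  open ListFold M

  -- The shape shared by 𝔪(λ)!, λ! and h_λ. A single multiplicativity lemma then serves both the
  -- weights in the exponential formula and the powers of x_j.
  foldDistinct : (Index m → ℕ → Carrier) → Columns m → Carrier
  foldDistinct φ λs = fold (distinctColumns λs) (λ d → φ d (multiplicity d λs))

  -- The condition on φ e 0 is for r = 0: then e is not among the distinct columns and contributes
  -- no factor on the left.
  foldDistinct-replicate : (φ : Index m → ℕ → Carrier) → ∀ r {e μ} → φ e 0 ≈ ε → e ∉ μ →
    foldDistinct φ (List.replicate r e ++ μ) ≈ φ e r ∙ foldDistinct φ μ
  foldDistinct-replicate φ zero                φe0 e∉ = sym (trans (∙-congʳ φe0) (identityˡ _))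
  foldDistinct-replicate φ r@(suc r-1) {e} {μ} φe0 e∉ = trans
    (reflexive (≡.cong (λ xs → fold xs (λ d → φ d (multiplicity d (List.replicate r e ++ μ))))
      (distinctColumns-replicate r-1 e∉)))
    (∙-cong
      (reflexive (≡.cong (φ e) (multiplicity-replicate-same r e∉)))
      (fold-cong-∈ (distinctColumns μ) λ d d∈ → reflexive (≡.cong (φ d)
        (multiplicity-replicate-other r {d} {e} {μ} (λ { refl → e∉ (distinctColumns⊆ μ d∈) })))))

-- Additivity of the exponential and its expansion over partitions

module ExponentialFormula (R : CommutativeRing c ℓ) (recip : ℕ → CommutativeRing.Carrier R)
                          (recip-inverse : Reciprocals.IsReciprocal R recip) (m : ℕ) where
  open CommutativeRing R hiding (zero) renaming (refl to ≈-refl)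
  open BigOperators R
  open FormalSeries R recip m
  open FormalExponential R recip recip-inverse m
  open ListFold +-commutativeMonoid
  open Convolution +-commutativeMonoid
  open RingSums R
  open Reciprocals R using (recip-1)
  open DistinctColumns *-commutativeMonoid using (foldDistinct; foldDistinct-replicate)
  open SetoidReasoning setoid
  private
    D = dividedPower

  -- In each term of F * F^r, either k = 0 and F vanishes there, or i - k has smaller degree than i
  -- and the induction hypothesis kills the other factor.
  ^ₛ-order : ∀ {F} → F 0ᵢ ≈ 0# → ∀ r i → ∣ i ∣ᵢ ℕ.< r → (F ^ₛ r) i ≈ 0#
  ^ₛ-order {F} F0 (suc r) i (s≤s i≤r) = fold-ε (below i) vanish
    where
    vanish : ∀ k → k ∈ below i → F k * (F ^ₛ r) (i ∸ᵢ k) ≈ 0#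
    vanish k k∈ with ∣ k ∣ᵢ in eq
    ... | zero  = trans (*-congʳ (trans (reflexive (≡.cong F (∣∣ᵢ≡0 k eq))) F0)) (zeroˡ _)
    ... | suc l = trans (*-congˡ (^ₛ-order F0 r (i ∸ᵢ k) (ℕₚ.≤-trans smaller i≤r))) (zeroʳ _)
      where
      smaller : ∣ i ∸ᵢ k ∣ᵢ ℕ.< ∣ i ∣ᵢ
      smaller = ≡.subst (∣ i ∸ᵢ k ∣ᵢ ℕ.<_) (∣∣ᵢ-∸ (Enumeration.∈-below⁻ k i k∈))
        (≡.subst (λ z → ∣ i ∸ᵢ k ∣ᵢ ℕ.< z ℕ.+ ∣ i ∸ᵢ k ∣ᵢ) (≡.sym eq) (s≤s (ℕₚ.m≤n+m _ l)))

  dividedPower-order : ∀ {F} → F 0ᵢ ≈ 0# → ∀ i r → ∣ i ∣ᵢ ℕ.< r → D r F i ≈ 0#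
  dividedPower-order F0 i r i<r = trans (*-congˡ (^ₛ-order F0 r i i<r)) (zeroʳ _)

  -- Gives the exponentials at all k below i one common cutoff, so that the sums over k and over r
  -- can be exchanged.
  expₛ-truncate : ∀ {F} → F 0ᵢ ≈ 0# → ∀ i {N} → ∣ i ∣ᵢ ℕ.≤ N →
                  (∑[ r ∈ upTo (suc N) ] D r F i) ≈ expₛ F i
  expₛ-truncate {F} F0 i i≤N =
    fold-upTo-extend (λ r → D r F i) (s≤s i≤N) (dividedPower-order F0 i)

  -- The triangle p + q ≤ P + Q contains the rectangle p ≤ P, q ≤ Q, and every product outside the
  -- rectangle vanishes.
  cauchy-product : ∀ {u v : ℕ → Carrier} P Q →
    (∀ p → P ℕ.< p → u p ≈ 0#) → (∀ q → Q ℕ.< q → v q ≈ 0#) →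
    (∑[ r ∈ upTo (suc (P ℕ.+ Q)) ] convℕ r (λ p q → u p * v q)) ≈
    (∑ (upTo (suc P)) u) * (∑ (upTo (suc Q)) v)
  cauchy-product {u} {v} P Q u≈0 v≈0 = begin
    (∑[ r ∈ upTo (suc N) ] convℕ r (λ p q → u p * v q))
      ≡⟨ convℕ-fold N _ ⟨
    -- The outer sum becomes a convolution whose second argument, the slack N - r, is ignored;
    -- associativity then sums the triangle row by row.
    convℕ N (λ r _ → convℕ r (λ p q → u p * v q))
      ≈⟨ convℕ-assoc N (λ p q _ → u p * v q) ⟨
    convℕ N (λ p s → convℕ s (λ q _ → u p * v q))
      ≈⟨ convℕ-cong N (λ p s p+s≡N → trans (sym (convℕ-*ˡ s _ (u p))) (extend p s p+s≡N)) ⟩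
    convℕ N (λ p _ → u p * V)
      ≡⟨ convℕ-fold N _ ⟩
    (∑[ p ∈ upTo (suc N) ] u p * V)
      ≈⟨ ∑-*ʳ (upTo (suc N)) u V ⟨
    (∑ (upTo (suc N)) u) * V
      ≈⟨ *-congʳ (fold-upTo-extend u (s≤s (ℕₚ.m≤m+n P Q)) u≈0) ⟩
    (∑ (upTo (suc P)) u) * V ∎
    where
    N = P ℕ.+ Q
    V = ∑ (upTo (suc Q)) v

    -- A row with p ≤ P has length bound s = P + Q - p ≥ Q, so it already contains every v that may
    -- be nonzero; for p > P both sides are zero.
    extend : ∀ p s → p ℕ.+ s ≡ N → u p * convℕ s (λ q _ → v q) ≈ u p * V
    extend p s p+s≡N with p ℕₚ.≤? P
    ... | yes p≤P = *-congˡ (trans (reflexive (convℕ-fold s _)) (fold-upTo-extend v (s≤s Q≤s) v≈0))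
      where
      Q≤s : Q ℕ.≤ s
      Q≤s = ℕₚ.+-cancelˡ-≤ p Q s (≡.subst (p ℕ.+ Q ℕ.≤_) (≡.sym p+s≡N) (ℕₚ.+-monoˡ-≤ Q p≤P))
    ... | no p≰P = trans (*-congʳ up≈0) (trans (zeroˡ _) (sym (trans (*-congʳ up≈0) (zeroˡ V))))
      where up≈0 = u≈0 p (ℕₚ.≰⇒> p≰P)

  -- For k ≤ i the degrees of k and i - k add up to that of i, so the cutoff on the left is exactly
  -- the sum of the cutoffs of the two factors, as the Cauchy product requires.
  expₛ-+ : ∀ {F G} → F 0ᵢ ≈ 0# → G 0ᵢ ≈ 0# → expₛ (F +ₛ G) ≈ₛ expₛ F *ₛ expₛ G
  expₛ-+ {F} {G} F0 G0 i = begin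
    (∑[ r ∈ upTo (suc ∣ i ∣ᵢ) ] D r (F +ₛ G) i)
      ≈⟨ fold-cong (upTo (suc ∣ i ∣ᵢ)) (λ r → expand r) ⟩
    (∑[ r ∈ upTo (suc ∣ i ∣ᵢ) ] ∑[ k ∈ below i ] convℕ r (λ p q → D p F k * D q G (i ∸ᵢ k)))
      ≈⟨ fold-swap (upTo (suc ∣ i ∣ᵢ)) (below i) _ ⟩
    (∑[ k ∈ below i ] ∑[ r ∈ upTo (suc ∣ i ∣ᵢ) ] convℕ r (λ p q → D p F k * D q G (i ∸ᵢ k)))
      ≈⟨ fold-cong-∈ (below i) (λ k k∈ → factorise k (Enumeration.∈-below⁻ k i k∈)) ⟩
    (expₛ F *ₛ expₛ G) i ∎
    where
    expand : ∀ r → D r (F +ₛ G) i ≈ (∑[ k ∈ below i ] convℕ r (λ p q → D p F k * D q G (i ∸ᵢ k)))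
    expand r = begin
      D r (F +ₛ G) i
        ≈⟨ dividedPower-+ r F G i ⟩
      convℕ r (λ p q → (D p F *ₛ D q G) i)
        ≈⟨ convℕ-cong r (λ p q _ → reflexive (*ₛ-conv (D p F) (D q G) i)) ⟩
      convℕ r (λ p q → conv i (λ k l → D p F k * D q G l))
        ≈⟨ conv-convℕ-swap i r _ ⟨
      conv i (λ k l → convℕ r (λ p q → D p F k * D q G l))
        ≡⟨ conv-fold i _ ⟩
      (∑[ k ∈ below i ] convℕ r (λ p q → D p F k * D q G (i ∸ᵢ k))) ∎

    factorise : ∀ k → k ≤ᵢ i →
      (∑[ r ∈ upTo (suc ∣ i ∣ᵢ) ] convℕ r (λ p q → D p F k * D q G (i ∸ᵢ k))) ≈
      expₛ F k * expₛ G (i ∸ᵢ k)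
    factorise k k≤i = trans
      (reflexive (≡.cong (λ N → ∑[ r ∈ upTo (suc N) ] convℕ r (λ p q → D p F k * D q G (i ∸ᵢ k)))
        (≡.sym (∣∣ᵢ-∸ k≤i))))
      (cauchy-product ∣ k ∣ᵢ ∣ i ∸ᵢ k ∣ᵢ
        (dividedPower-order F0 k) (dividedPower-order G0 (i ∸ᵢ k)))

  -- A coefficient of a power at i involves only indices below i. For the exponential at i this
  -- allows an infinite series to be replaced by finitely many monomials.
  ^ₛ-cong-below : ∀ {F G} r i → (∀ k → k ≤ᵢ i → F k ≈ G k) → (F ^ₛ r) i ≈ (G ^ₛ r) i
  ^ₛ-cong-below zero    i F≈G = ≈-refl
  ^ₛ-cong-below (suc r) i F≈G = fold-cong-∈ (below i) λ k k∈ →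
    let k≤i = Enumeration.∈-below⁻ k i k∈ in
    *-cong (F≈G k k≤i)
      (^ₛ-cong-below r (i ∸ᵢ k) (λ l l≤ → F≈G l (≡.subst (l ≤ᵢ_) (Enumeration.+-∸ᵢ k≤i) (Enumeration.+ᵢ-≤ʳ k l≤))))

  expₛ-cong-below : ∀ {F G} i → (∀ k → k ≤ᵢ i → F k ≈ G k) → expₛ F i ≈ expₛ G i
  expₛ-cong-below i F≈G = fold-cong (upTo (suc ∣ i ∣ᵢ)) (λ r → *-congˡ (^ₛ-cong-below r i F≈G))

  expₛ-0 : expₛ (λ _ → 0#) ≈ₛ 1ₛ
  expₛ-0 i = begin
    expₛ (λ _ → 0#) i
      ≈⟨ fold-upTo-suc ∣ i ∣ᵢ (λ r → D r (λ _ → 0#) i) ⟩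
    recip 1 * 1ₛ i + (∑[ r ∈ upTo ∣ i ∣ᵢ ] D (suc r) (λ _ → 0#) i)
      ≈⟨ +-cong (trans (*-congʳ (recip-1 recip-inverse)) (*-identityˡ _))
           (fold-ε (upTo ∣ i ∣ᵢ) (λ r _ → trans (*-congˡ (fold-ε (below i) (λ k _ → zeroˡ _))) (zeroʳ _))) ⟩
    1ₛ i + 0#
      ≈⟨ +-identityʳ _ ⟩
    1ₛ i ∎

  monomial-yes : ∀ a (e k : Index m) → k ≡ e → monomial a e k ≡ a
  monomial-yes a e _ refl with e ≟ᵢ e
  ... | yes _  = refl
  ... | no e≢e = contradiction refl e≢e

  monomial-no : ∀ a (e k : Index m) → k ≢ e → monomial a e k ≡ 0#
  monomial-no a e k k≢e with k ≟ᵢ e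
  ... | yes k≡e = contradiction k≡e k≢e
  ... | no _    = refl

  monomial-^ₛ : ∀ a e r → monomial a e ^ₛ r ≈ₛ monomial (a ^ r) (r ·ᵢ e)
  monomial-^ₛ a e zero    i = reflexive (≡.cong (λ d → monomial 1# d i) (≡.sym (Enumeration.·ᵢ-zero e)))
  monomial-^ₛ a e (suc r) i = begin
    (monomial a e *ₛ monomial a e ^ₛ r) i
      ≈⟨ *ₛ-cong {monomial a e} (λ _ → ≈-refl) (monomial-^ₛ a e r) i ⟩
    (monomial a e *ₛ monomial (a ^ r) (r ·ᵢ e)) i
      ≈⟨ monomial-*ₛ a e (monomial (a ^ r) (r ·ᵢ e)) i ⟩
    (if ⌊ e ≤ᵢ? i ⌋ then a * monomial (a ^ r) (r ·ᵢ e) (i ∸ᵢ e) else 0#)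
      ≈⟨ shift ⟩
    monomial (a * a ^ r) (e +ᵢ r ·ᵢ e) i
      ≡⟨ ≡.cong (λ d → monomial (a * a ^ r) d i) (Enumeration.·ᵢ-suc r e) ⟨
    monomial (a * a ^ r) (suc r ·ᵢ e) i ∎
    where
    shift : (if ⌊ e ≤ᵢ? i ⌋ then a * monomial (a ^ r) (r ·ᵢ e) (i ∸ᵢ e) else 0#) ≈
            monomial (a * a ^ r) (e +ᵢ r ·ᵢ e) i
    shift with e ≤ᵢ? i
    ... | no e≰i  = reflexive (≡.sym (monomial-no _ _ i λ { refl → e≰i (Enumeration.≤ᵢ-+ e _) }))
    ... | yes e≤i with i ∸ᵢ e ≟ᵢ r ·ᵢ e
    ...   | yes eq = reflexive (≡.sym (monomial-yes _ _ i
                       (≡.trans (≡.sym (Enumeration.+-∸ᵢ e≤i)) (≡.cong (e +ᵢ_) eq))))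
    ...   | no neq = trans (zeroʳ a) (reflexive (≡.sym (monomial-no _ _ i
                       λ { refl → neq (Enumeration.∸-+ᵢ e _) })))

  -- The range of r is the one in `partitionsInto`, where r counts the copies of e, so that the two
  -- recursions agree term by term. As e is nonzero there is no constant term, which makes the
  -- common cutoff at i legitimate.
  expₛ-monomial-*ₛ : ∀ a {e} → e ≢ 0ᵢ → ∀ H i →
    (expₛ (monomial a e) *ₛ H) i ≈
    (∑[ r ∈ filter (λ r → r ·ᵢ e ≤ᵢ? i) (upTo (suc ∣ i ∣ᵢ)) ] recip (r !) * a ^ r * H (i ∸ᵢ r ·ᵢ e))
  expₛ-monomial-*ₛ a {e} e≢0 H i = begin
    (∑[ k ∈ below i ] expₛ M k * H (i ∸ᵢ k))
      ≈⟨ fold-cong-∈ (below i) (λ k k∈ → trans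
           (*-congʳ (sym (expₛ-truncate M0 k (Enumeration.∣∣ᵢ-mono (Enumeration.∈-below⁻ k i k∈)))))
           (∑-*ʳ rs _ _)) ⟩
    (∑[ k ∈ below i ] ∑[ r ∈ rs ] D r M k * H (i ∸ᵢ k))
      ≈⟨ fold-swap (below i) rs _ ⟩
    (∑[ r ∈ rs ] (D r M *ₛ H) i)
      ≈⟨ fold-cong rs (λ r → trans (*ₛ-cong {G = H} (power r) (λ _ → ≈-refl) i)
                                   (monomial-*ₛ (recip (r !) * a ^ r) (r ·ᵢ e) H i)) ⟩
    (∑[ r ∈ rs ] (if ⌊ r ·ᵢ e ≤ᵢ? i ⌋ then recip (r !) * a ^ r * H (i ∸ᵢ r ·ᵢ e) else 0#))
      ≈⟨ fold-filter (λ r → r ·ᵢ e ≤ᵢ? i) rs _ ⟨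
    (∑[ r ∈ filter (λ r → r ·ᵢ e ≤ᵢ? i) rs ] recip (r !) * a ^ r * H (i ∸ᵢ r ·ᵢ e)) ∎
    where
    M  = monomial a e
    rs = upTo (suc ∣ i ∣ᵢ)

    M0 : M 0ᵢ ≈ 0#
    M0 = reflexive (monomial-no a e 0ᵢ (e≢0 ∘ ≡.sym))

    power : ∀ r → D r M ≈ₛ monomial (recip (r !) * a ^ r) (r ·ᵢ e)
    power r k with k ≟ᵢ r ·ᵢ e | monomial-^ₛ a e r k
    ... | yes _ | eq = *-congˡ eq
    ... | no _  | eq = trans (*-congˡ eq) (zeroʳ _)

  module _ (G : Series) where

    supportedOn : Columns m → Series
    supportedOn cs k = ∑[ e ∈ cs ] monomial (G e) e k

    -- The contribution of r copies of e. Over the distinct columns of λ the reciprocal factorials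
    -- multiply to 1/𝔪(λ)!.
    columnWeight : Index m → ℕ → Carrier
    columnWeight e r = recip (r !) * G e ^ r

    supportedOn-0 : ∀ {cs} → All (_≢ 0ᵢ) cs → supportedOn cs 0ᵢ ≈ 0#
    supportedOn-0 {cs} nz = fold-ε cs (λ e e∈ → reflexive (monomial-no (G e) e 0ᵢ (All.lookup nz e∈ ∘ ≡.sym)))

    -- Induction along `partitionsInto`: additivity of exp splits off the monomial of the first
    -- column e. Since cs has no repetition, e does not occur in the partitions built from the other
    -- columns, so the weights multiply.
    expₛ-supportedOn : ∀ {cs} → Unique cs → All (_≢ 0ᵢ) cs → ∀ k →
      expₛ (supportedOn cs) k ≈ (∑[ λs ∈ partitionsInto cs k ] foldDistinct columnWeight λs)
    expₛ-supportedOn {[]} _ _ k with k ≟ᵢ 0ᵢ | expₛ-0 k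
    ... | yes _ | eq = trans eq (sym (+-identityʳ 1#))
    ... | no _  | eq = eq
    expₛ-supportedOn {e ∷ cs} (e∉ ∷ u) (e≢0 ∷ nz) k = begin
      expₛ (supportedOn (e ∷ cs)) k
        ≈⟨ expₛ-+ (reflexive (monomial-no (G e) e 0ᵢ (e≢0 ∘ ≡.sym))) (supportedOn-0 nz) k ⟩
      (expₛ (monomial (G e) e) *ₛ expₛ (supportedOn cs)) k
        ≈⟨ expₛ-monomial-*ₛ (G e) e≢0 (expₛ (supportedOn cs)) k ⟩
      (∑[ r ∈ rs ] columnWeight e r * expₛ (supportedOn cs) (k ∸ᵢ r ·ᵢ e))
        ≈⟨ fold-cong rs (λ r → trans (*-congˡ (expₛ-supportedOn u nz (k ∸ᵢ r ·ᵢ e))) (block r)) ⟩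
      (∑[ r ∈ rs ] ∑[ λs ∈ map (List.replicate r e ++_) (partitionsInto cs (k ∸ᵢ r ·ᵢ e)) ] foldDistinct columnWeight λs)
        ≈⟨ fold-concatMap _ rs _ ⟨
      (∑[ λs ∈ partitionsInto (e ∷ cs) k ] foldDistinct columnWeight λs) ∎
      where
      rs = filter (λ r → r ·ᵢ e ≤ᵢ? k) (upTo (suc ∣ k ∣ᵢ))

      weight-0 : columnWeight e 0 ≈ 1#
      weight-0 = trans (*-identityʳ _) (recip-1 recip-inverse)

      block : ∀ r →
        columnWeight e r * (∑[ λs ∈ partitionsInto cs (k ∸ᵢ r ·ᵢ e) ] foldDistinct columnWeight λs) ≈
        (∑[ λs ∈ map (List.replicate r e ++_) (partitionsInto cs (k ∸ᵢ r ·ᵢ e)) ] foldDistinct columnWeight λs)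
      block r = begin
        columnWeight e r * (∑[ μs ∈ ps ] foldDistinct columnWeight μs)
          ≈⟨ ∑-*ˡ ps _ _ ⟩
        (∑[ μs ∈ ps ] columnWeight e r * foldDistinct columnWeight μs)
          ≈⟨ fold-cong-∈ ps (λ μs μs∈ → foldDistinct-replicate columnWeight r weight-0
               (λ e∈ → All.lookup e∉ (All.lookup (Enumeration.columns-into cs μs∈) e∈) refl)) ⟨
        (∑[ μs ∈ ps ] foldDistinct columnWeight (List.replicate r e ++ μs))
          ≡⟨ fold-map (List.replicate r e ++_) ps _ ⟨
        (∑[ λs ∈ map (List.replicate r e ++_) ps ] foldDistinct columnWeight λs) ∎
        where ps = partitionsInto cs (k ∸ᵢ r ·ᵢ e)

    -- At k only the monomials of G with index below k matter. Their nonzero indices are the columns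
    -- from which `partitions k` is built, and the vanishing constant term accounts for the omitted
    -- index 0.
    expₛ-partitions : G 0ᵢ ≈ 0# → ∀ k →
      expₛ G k ≈ (∑[ λs ∈ partitions k ] foldDistinct columnWeight λs)
    expₛ-partitions G0 k = trans
      (expₛ-cong-below k agree)
      (expₛ-supportedOn (nonzeroBelow-unique k) (nonzeroBelow-nonzero k) k)
      where
      -- `monomial` tests the index against the column, while the delta sum tests the column against
      -- the index.
      flip : ∀ l e → monomial (G e) e l ≡ (if ⌊ e ≟ᵢ l ⌋ then G e else 0#)
      flip l e with e ≟ᵢ l
      ... | yes e≡l = monomial-yes (G e) e l (≡.sym e≡l)
      ... | no e≢l  = monomial-no (G e) e l (e≢l ∘ ≡.sym)

      agree : ∀ l → l ≤ᵢ k → G l ≈ supportedOn (nonzeroBelow k) l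
      agree l l≤k with l ≟ᵢ 0ᵢ
      ... | yes refl = trans G0 (sym (supportedOn-0 (nonzeroBelow-nonzero k)))
      ... | no l≢0   = sym (trans
        (fold-cong (nonzeroBelow k) (λ e → reflexive (flip l e)))
        (fold-delta-∈ _≟ᵢ_ G (nonzeroBelow-unique k) (∈-filter⁺ _ (Enumeration.∈-below⁺ l≤k) l≢0)))

  -- Each application of additivity introduces a first index k below i and leaves i - k to the other
  -- series, which is the recursion of `decompositions`.
  expₛ-∑ᶠ : ∀ n (F : Fin n → Series) → (∀ j → F j 0ᵢ ≈ 0#) → ∀ i →
    expₛ (λ k → ∑ᶠ (λ j → F j k)) i ≈
    (∑[ ks ∈ decompositions n i ] ∏ᶠ (λ j → expₛ (F j) (lookup ks j)))
  expₛ-∑ᶠ zero F F0 i with i ≟ᵢ 0ᵢ | expₛ-0 i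
  ... | yes _ | eq = trans eq (sym (+-identityʳ 1#))
  ... | no _  | eq = eq
  expₛ-∑ᶠ (suc n) F F0 i = begin
    expₛ (λ k → ∑ᶠ (λ j → F j k)) i
      ≈⟨ expₛ-+ (F0 zero) (rest0 n (F ∘ suc) (F0 ∘ suc)) i ⟩
    (∑[ k ∈ below i ] expₛ (F zero) k * expₛ (λ k → ∑ᶠ (λ j → F (suc j) k)) (i ∸ᵢ k))
      ≈⟨ fold-cong (below i) (λ k → block k) ⟩
    (∑[ k ∈ below i ] ∑ (map (k ∷_) (decompositions n (i ∸ᵢ k))) term)
      ≈⟨ fold-concatMap _ (below i) term ⟨
    ∑ (decompositions (suc n) i) term ∎
    where
    term : Vec (Index m) (suc n) → Carrier
    term ks = ∏ᶠ (λ j → expₛ (F j) (lookup ks j))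

    rest0 : ∀ n (F : Fin n → Series) → (∀ j → F j 0ᵢ ≈ 0#) → ∑ᶠ (λ j → F j 0ᵢ) ≈ 0#
    rest0 zero    F F0 = ≈-refl
    rest0 (suc n) F F0 = trans (+-cong (F0 zero) (rest0 n (F ∘ suc) (F0 ∘ suc))) (+-identityˡ 0#)

    block : ∀ k → expₛ (F zero) k * expₛ (λ k → ∑ᶠ (λ j → F (suc j) k)) (i ∸ᵢ k) ≈
                  ∑ (map (k ∷_) (decompositions n (i ∸ᵢ k))) term
    block k = begin
      expₛ (F zero) k * expₛ (λ k → ∑ᶠ (λ j → F (suc j) k)) (i ∸ᵢ k)
        ≈⟨ *-congˡ (expₛ-∑ᶠ n (F ∘ suc) (F0 ∘ suc) (i ∸ᵢ k)) ⟩
      expₛ (F zero) k * (∑[ ks ∈ decompositions n (i ∸ᵢ k) ] ∏ᶠ (λ j → expₛ (F (suc j)) (lookup ks j)))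
        ≈⟨ ∑-*ˡ (decompositions n (i ∸ᵢ k)) _ _ ⟩
      (∑[ ks ∈ decompositions n (i ∸ᵢ k) ] term (k ∷ ks))
        ≡⟨ fold-map (k ∷_) (decompositions n (i ∸ᵢ k)) term ⟨
      ∑ (map (k ∷_) (decompositions n (i ∸ᵢ k))) term ∎

  ∏ᶠ-∑ : ∀ {X : Set b} (xss : Vec (List X) n) (w : Fin n → X → Carrier) →
         ∏ᶠ (λ j → ∑ (lookup xss j) (w j)) ≈ (∑[ ys ∈ choices xss ] ∏ᶠ (λ j → w j (lookup ys j)))
  ∏ᶠ-∑ []         w = sym (+-identityʳ 1#)
  ∏ᶠ-∑ (xs ∷ xss) w = begin
    ∑ xs (w zero) * ∏ᶠ (λ j → ∑ (lookup xss j) (w (suc j)))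
      ≈⟨ *-congˡ (∏ᶠ-∑ xss (w ∘ suc)) ⟩
    ∑ xs (w zero) * (∑[ ys ∈ choices xss ] ∏ᶠ (λ j → w (suc j) (lookup ys j)))
      ≈⟨ trans (∑-*ʳ xs _ _) (fold-cong xs (λ x → ∑-*ˡ (choices xss) _ _)) ⟩
    (∑[ x ∈ xs ] ∑[ ys ∈ choices xss ] w zero x * ∏ᶠ (λ j → w (suc j) (lookup ys j)))
      ≈⟨ fold-cartesianProductWith _∷_ xs (choices xss) _ ⟨
    (∑[ ys ∈ choices (xs ∷ xss) ] ∏ᶠ (λ j → w j (lookup ys j))) ∎

-- Nonvanishing denominators and total multiplicity

!ᵢ-nonZero : (k : Index m) → NonZero (k !ᵢ)
!ᵢ-nonZero []       = _
!ᵢ-nonZero (k ∷ ks) = ℕₚ.m*n≢0 (k !) (ks !ᵢ) {{k ℕₚ.!≢0}} {{ !ᵢ-nonZero ks}}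

!ᵢ-product-nonZero : (ks : Vec (Index m) n) → NonZero (Vec.foldr′ ℕ._*_ 1 (Vec.map _!ᵢ ks))
!ᵢ-product-nonZero []       = _
!ᵢ-product-nonZero (k ∷ ks) =
  ℕₚ.m*n≢0 (k !ᵢ) _ {{ !ᵢ-nonZero k}} {{ !ᵢ-product-nonZero ks}}

product-map-nonZero : (f : B → ℕ) → (∀ x → NonZero (f x)) → ∀ xs → NonZero (product (map f xs))
product-map-nonZero f f≢0 xs = product≢0 (Allₚ.map⁺ (All.universal f≢0 xs))

!-nonZero : ∀ k → NonZero (k !)
!-nonZero k = k ℕₚ.!≢0

𝔪!-nonZero : (λs : Columns m) → NonZero 𝔪[ λs ]!
𝔪!-nonZero λs = product-map-nonZero _ (λ e → !-nonZero (multiplicity e λs)) (distinctColumns λs)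

!ᵢ^-nonZero : (e : Index m) (r : ℕ) → NonZero (e !ᵢ ℕ.^ r)
!ᵢ^-nonZero e r = ℕₚ.m^n≢0 (e !ᵢ) r {{ !ᵢ-nonZero e}}

!ₚ-nonZero : (λs : Columns m) → NonZero (λs !ₚ)
!ₚ-nonZero λs = product-map-nonZero _ (λ e → !ᵢ^-nonZero e (multiplicity e λs)) (distinctColumns λs)

module _ (R : CommutativeRing c ℓ) where
  open CommutativeRing R hiding (zero) renaming (refl to ≈-refl)
  open BigOperators R
  open DistinctColumns *-commutativeMonoid
  open CommutativeSemiringExp commutativeSemiring using (^-homo-*)

  -- The multiplicities of the distinct columns add up to the number of columns. Induction along
  -- `partitionsInto` presents equal columns as one block.
  foldDistinct-^ : ∀ x {cs : Columns m} → Unique cs → ∀ {k λs} → λs ∈ partitionsInto cs k →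
                   foldDistinct (λ _ r → x ^ r) λs ≈ x ^ List.length λs
  foldDistinct-^ x {[]}     _        {k} p with k ≟ᵢ 0ᵢ | p
  ... | yes _ | here refl = ≈-refl
  foldDistinct-^ x {e ∷ cs} (e∉ ∷ u) p
    with r , μs , _ , μs∈ , refl ← Enumeration.partitionsInto-step⁻ e cs p = trans
    (foldDistinct-replicate (λ _ r → x ^ r) r ≈-refl
      (λ e∈ → All.lookup e∉ (All.lookup (Enumeration.columns-into cs μs∈) e∈) refl))
    (trans (*-congˡ (foldDistinct-^ x u μs∈))
      (trans (sym (^-homo-* x r (List.length μs)))
        (reflexive (≡.cong (x ^_) (≡.sym (≡.trans (Listₚ.length-++ (List.replicate r e))
          (≡.cong (ℕ._+ List.length μs) (Listₚ.length-replicate r))))))))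

-- Constants and substitution in polynomial rings

module PolynomialProperties (R : CommutativeRing c ℓ) where
  open CommutativeRing R using (Carrier; 1#)
  open Polynomials R
  open SemiringMult (CommutativeRing.semiring R) using (_×_)
  open BigOperators R using (∏; ∏ᶠ; _^_)
  private
    module PolyRing {v} (V : Set v) where
      open CommutativeRing (polyRing V) public
      open BigOperators (polyRing V) public
      open SemiringMult semiring public using (_×_)

  con-× : ∀ {v} {V : Set v} k r → con (k × r) ≋ PolyRing._×_ V k (con r)
  con-× zero    r = ≋-refl
  con-× (suc k) r = ≋-trans (con-⊕ r (k × r)) (⊕-cong ≋-refl (con-× k r))

  con-^ : ∀ {v} {V : Set v} r k → con (r ^ k) ≋ PolyRing._^_ V (con r) k
  con-^ r zero    = ≋-refl
  con-^ r (suc k) = ≋-trans (con-⊗ r (r ^ k)) (⊗-cong ≋-refl (con-^ r k))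

  con-∏ : ∀ {v} {V : Set v} (xs : List B) (f : B → Carrier) → con (∏ xs f) ≋ PolyRing.∏ V xs (con ∘ f)
  con-∏ []       f = ≋-refl
  con-∏ (x ∷ xs) f = ≋-trans (con-⊗ (f x) _) (⊗-cong ≋-refl (con-∏ xs f))

  con-∏ᶠ : ∀ {v} {V : Set v} (f : Fin n → Carrier) → con (∏ᶠ f) ≋ PolyRing.∏ᶠ V (con ∘ f)
  con-∏ᶠ {n = zero}  f = ≋-refl
  con-∏ᶠ {n = suc n} f = ≋-trans (con-⊗ (f zero) _) (⊗-cong ≋-refl (con-∏ᶠ (f ∘ suc)))

  -- Makes the exponential formula available with polynomial coefficients, because `con` preserves
  -- products and natural multiples.
  con-isReciprocal : ∀ {v} {V : Set v} {recip} → Reciprocals.IsReciprocal R recip →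
                     Reciprocals.IsReciprocal (polyRing V) (con ∘ recip)
  con-isReciprocal {recip = recip} inv k =
    ≋-trans (⊗-cong ≋-refl (≋-sym (con-× k 1#)))
      (≋-trans (≋-sym (con-⊗ (recip k) (k × 1#))) (con-cong (inv k)))

  module _ {v w} {V : Set v} {W : Set w} (σ : V → Poly W) where

    -- Substitution is structural on expressions, so it commutes with powers up to `≡` and not only
    -- up to `≋`.
    ^-[] : ∀ p k → (PolyRing._^_ V p k) [ σ ] ≡ PolyRing._^_ W (p [ σ ]) k
    ^-[] p zero    = refl
    ^-[] p (suc k) = ≡.cong ((p [ σ ]) ⊗_) (^-[] p k)

    ∏ᶠ-[] : (f : Fin n → Poly V) → (PolyRing.∏ᶠ V f) [ σ ] ≡ PolyRing.∏ᶠ W (λ j → f j [ σ ])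
    ∏ᶠ-[] {n = zero}  f = refl
    ∏ᶠ-[] {n = suc n} f = ≡.cong ((f zero [ σ ]) ⊗_) (∏ᶠ-[] (f ∘ suc))

-- Factorial quotients in characteristic zero

module CharacteristicZero {c ℓ₁ ℓ₂} (K : CharacteristicZeroField c ℓ₁ ℓ₂) where
  open CharacteristicZeroField K using (commutativeRing; fromℕ; recip; _÷_; characteristicZero; #⇒invertible)
  open CommutativeRing commutativeRing hiding (zero) renaming (refl to ≈-refl)
  open BigOperators commutativeRing
  open Reciprocals commutativeRing
  open SemiringMult semiring using (×1-homo-*)
  open RingProperties ring using (-0#≈0#)
  open SetoidReasoning setoid

  recip-inverse : IsReciprocal recip
  recip-inverse (suc k) = trans
    -- `#⇒invertible` inverts the difference of the two elements that are apart, here suc k minus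
    -- zero, so the zero has to be removed.
    (*-congˡ (sym (trans (+-congˡ -0#≈0#) (+-identityʳ _))))
    (proj₁ (proj₂ (#⇒invertible (characteristicZero k))))

  recip-product : (f : B → ℕ) → (∀ x → NonZero (f x)) → ∀ xs →
                  recip (product (map f xs)) ≈ (∏[ x ∈ xs ] recip (f x))
  recip-product f f≢0 []       = recip-1 recip-inverse
  recip-product f f≢0 (x ∷ xs) = trans
    (recip-* recip-inverse (f x) _ {{f≢0 x}} {{product-map-nonZero f f≢0 xs}})
    (*-congˡ (recip-product f f≢0 xs))

  recip-^ : ∀ k r .{{_ : NonZero k}} → recip (k ℕ.^ r) ≈ recip k ^ r
  recip-^ k zero    = recip-1 recip-inverse
  recip-^ k (suc r) {{k≢0}} = trans
    (recip-* recip-inverse k (k ℕ.^ r) {{k≢0}} {{ℕₚ.m^n≢0 k r}}) (*-congˡ (recip-^ k r))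

  fromℕ-!ᵢ-product : (ks : Vec (Index m) n) →
    fromℕ (Vec.foldr′ ℕ._*_ 1 (Vec.map _!ᵢ ks)) ≈ ∏ᶠ (λ j → fromℕ (lookup ks j !ᵢ))
  fromℕ-!ᵢ-product []       = +-identityʳ 1#
  fromℕ-!ᵢ-product (k ∷ ks) = trans (×1-homo-* (k !ᵢ) _) (*-congˡ (fromℕ-!ᵢ-product ks))

  -- The auxiliary moment divides by all the k_j! in the multinomial coefficient and multiplies by
  -- them again in the factors. The Bell side contains neither, so a quotient Q/Q = 1 is inserted
  -- and distributed.
  multinomial-cancel : ∀ N (ks : Vec (Index m) n) (d : Fin n → ℕ) (h : Fin n → Carrier) →
    fromℕ N * ∏ᶠ (λ j → recip (d j) * h j) ≈
    N ÷ Vec.foldr′ ℕ._*_ 1 (Vec.map _!ᵢ ks) * ∏ᶠ (λ j → lookup ks j !ᵢ ÷ d j * h j)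
  multinomial-cancel {n = n} N ks d h = begin
    fromℕ N * ∏ᶠ (λ j → recip (d j) * h j)
      ≈⟨ *-congʳ (*-identityʳ _) ⟨
    fromℕ N * 1# * ∏ᶠ (λ j → recip (d j) * h j)
      ≈⟨ *-congʳ (*-congˡ (trans (sym (*-congˡ (fromℕ-!ᵢ-product ks)))
           (recip-inverse Q {{ !ᵢ-product-nonZero ks}}))) ⟨
    fromℕ N * (recip Q * ∏ᶠ (λ j → fromℕ (lookup ks j !ᵢ))) * ∏ᶠ (λ j → recip (d j) * h j)
      ≈⟨ trans (*-congʳ (sym (*-assoc _ _ _))) (*-assoc _ _ _) ⟩
    N ÷ Q * (∏ᶠ (λ j → fromℕ (lookup ks j !ᵢ)) * ∏ᶠ (λ j → recip (d j) * h j))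
      ≈⟨ *-congˡ (∑-distrib-+ (λ j → fromℕ (lookup ks j !ᵢ)) (λ j → recip (d j) * h j)) ⟨
    N ÷ Q * ∏ᶠ (λ j → fromℕ (lookup ks j !ᵢ) * (recip (d j) * h j))
      ≈⟨ *-congˡ (sum-cong-≋ {n} (λ j → sym (*-assoc _ _ _))) ⟩
    N ÷ Q * ∏ᶠ (λ j → lookup ks j !ᵢ ÷ d j * h j) ∎
    where
    open CommutativeMonoidSum *-commutativeMonoid using (∑-distrib-+; sum-cong-≋)
    Q = Vec.foldr′ ℕ._*_ 1 (Vec.map _!ᵢ ks)

-- Expansion of the Bell polynomial and its evaluation

module BellMoments {c ℓ₁ ℓ₂ a} (K : CharacteristicZeroField c ℓ₁ ℓ₂) {A : Set a} (ev : Evaluation K A)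
                   {m n : ℕ} (ν : Fin n → Fin m → Monomial A) where
  open CharacteristicZeroField K using (commutativeRing; fromℕ; recip; _÷_)
  open CharacteristicZero K
  open CommutativeRing commutativeRing using (Carrier; _≈_; _*_; 0#; 1#)
  open Polynomials commutativeRing
  open PolynomialProperties commutativeRing
  open Evaluation ev
  open Umbral K ev
  private
    module K  = CommutativeRing commutativeRing
    module KB = BigOperators commutativeRing
    polys     = polyRing (Fin n)
    module X  = CommutativeRing polys
    module XF = ListFold X.*-commutativeMonoid
    module KF = ListFold K.*-commutativeMonoid
    X-reciprocal = con-isReciprocal {V = Fin n} recip-inverse
  open BigOperators polys
  open FormalSeries polys (con ∘ recip) m
  open ExponentialFormula polys (con ∘ recip) X-reciprocal m
  open DistinctColumns X.*-commutativeMonoid using (foldDistinct)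
  open CommutativeSemiringExp X.commutativeSemiring using (^-distrib-*; ^-congˡ)
  open SetoidReasoning X.setoid

  summand : Fin n → Series
  summand j k = var j ⊗ (con (generatingFunction (ν j) k) X.- 1ₛ k)

  -- The 1 subtracted in the exponent cancels the constant term of the generating function; this
  -- supplies the hypothesis of the exponential lemmas.
  summand-0 : ∀ j → summand j 0ᵢ ≋ con 0#
  summand-0 j with 0ᵢ {m} ≟ᵢ 0ᵢ
  ... | yes _  = ≋-trans (⊗-cong ≋-refl (X.-‿inverseʳ (con 1#))) (X.zeroʳ (var j))
  ... | no 0≢0 = contradiction refl 0≢0

  summand-≢0 : ∀ j {e} → e ≢ 0ᵢ → summand j e ≋ con (moment (ν j) e * recip (e !ᵢ)) ⊗ var j
  summand-≢0 j {e} e≢0 with e ≟ᵢ 0ᵢ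
  ... | yes e≡0 = contradiction e≡0 e≢0
  ... | no _    = ≋-trans
    (⊗-cong ≋-refl (≋-trans (⊕-cong ≋-refl (RingProperties.-0#≈0# X.ring)) (X.+-identityʳ _)))
    (⊗-comm _ _)

  coefficient : Fin n → Columns m → Carrier
  coefficient j λs = recip (𝔪[ λs ]! ℕ.* λs !ₚ) * partitionMoment (ν j) λs

  -- The three factors are kept apart because their products over the distinct columns are 1/𝔪(λ)!,
  -- 1/λ! and h_λ.
  columnCoefficient : Fin n → Index m → ℕ → Carrier
  columnCoefficient j e r = recip (r !) * (recip (e !ᵢ ℕ.^ r) * moment (ν j) e KB.^ r)

  columnWeight-summand : ∀ j {e} → e ≢ 0ᵢ → ∀ r →
    columnWeight (summand j) e r ≋ con (columnCoefficient j e r) ⊗ var j ^ r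
  columnWeight-summand j {e} e≢0 r = begin
    con (recip (r !)) ⊗ summand j e ^ r
      ≈⟨ X.*-congˡ (^-congˡ r (summand-≢0 j e≢0)) ⟩
    con (recip (r !)) ⊗ (con (h * q) ⊗ var j) ^ r
      ≈⟨ X.*-congˡ (^-distrib-* (con (h * q)) (var j) r) ⟩
    con (recip (r !)) ⊗ (con (h * q) ^ r ⊗ var j ^ r)
      ≈⟨ X.*-assoc _ _ _ ⟨
    con (recip (r !)) ⊗ con (h * q) ^ r ⊗ var j ^ r
      ≈⟨ X.*-congʳ (X.*-congˡ (≋-trans (≋-sym (con-^ (h * q) r)) (con-cong powers))) ⟩
    con (recip (r !)) ⊗ con (recip (e !ᵢ ℕ.^ r) * h KB.^ r) ⊗ var j ^ r
      ≈⟨ X.*-congʳ (con-⊗ _ _) ⟨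
    con (columnCoefficient j e r) ⊗ var j ^ r ∎
    where
    h = moment (ν j) e
    q = recip (e !ᵢ)
    powers : (h * q) KB.^ r ≈ recip (e !ᵢ ℕ.^ r) * h KB.^ r
    powers = K.trans (CommutativeSemiringExp.^-distrib-* K.commutativeSemiring h q r)
      (K.trans (K.*-comm _ _) (K.*-congʳ (K.sym (recip-^ (e !ᵢ) r {{ !ᵢ-nonZero e}}))))

  ∏-columnCoefficient : ∀ j λs →
    KF.fold (distinctColumns λs) (λ e → columnCoefficient j e (multiplicity e λs)) ≈ coefficient j λs
  ∏-columnCoefficient j λs = K.trans (KF.fold-∙ ds _ _) (K.trans (K.*-congˡ (KF.fold-∙ ds _ _))
    (K.trans (K.sym (K.*-assoc _ _ _)) (K.*-congʳ (K.sym (K.trans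
      (Reciprocals.recip-* commutativeRing recip-inverse 𝔪[ λs ]! (λs !ₚ) {{𝔪!-nonZero λs}} {{ !ₚ-nonZero λs}})
      (K.*-cong (recip-product (λ e → multiplicity e λs !) (λ e → !-nonZero (multiplicity e λs)) ds)
                (recip-product (λ e → e !ᵢ ℕ.^ multiplicity e λs) (λ e → !ᵢ^-nonZero e (multiplicity e λs)) ds)))))))
    where ds = distinctColumns λs

  -- Membership in `partitions k` enters twice: the columns are nonzero, so their coefficients are
  -- moments, and they come in blocks, so the powers of x_j collect to the exponent l(λ).
  partitionWeight : ∀ j k λs → λs ∈ partitions k →
    foldDistinct (columnWeight (summand j)) λs ≋ con (coefficient j λs) ⊗ var j ^ List.length λs
  partitionWeight j k λs λs∈ = begin
    foldDistinct (columnWeight (summand j)) λs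
      ≈⟨ XF.fold-cong-∈ ds (λ e e∈ → columnWeight-summand j
           (All.lookup nonzero (distinctColumns⊆ λs e∈)) (multiplicity e λs)) ⟩
    XF.fold ds (λ e → con (columnCoefficient j e (multiplicity e λs)) ⊗ var j ^ multiplicity e λs)
      ≈⟨ XF.fold-∙ ds _ _ ⟩
    XF.fold ds (λ e → con (columnCoefficient j e (multiplicity e λs))) ⊗
      foldDistinct (λ _ r → var j ^ r) λs
      ≈⟨ ⊗-cong (≋-trans (≋-sym (con-∏ ds _)) (con-cong (∏-columnCoefficient j λs)))
                (foldDistinct-^ polys (var j) (nonzeroBelow-unique k) λs∈) ⟩
    con (coefficient j λs) ⊗ var j ^ List.length λs ∎
    where
    open _⊢_ (∈-partitions⁻ {k = k} λs∈)
    ds = distinctColumns λs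

  expₛ-summand : ∀ j k → expₛ (summand j) k ≋
    (∑[ λs ∈ partitions k ] con (coefficient j λs) ⊗ var j ^ List.length λs)
  expₛ-summand j k = ≋-trans (expₛ-partitions (summand j) (summand-0 j) k)
    (ListFold.fold-cong-∈ X.+-commutativeMonoid (partitions k) (partitionWeight j k))

  -- Grouped as in `auxiliaryMoment`: after evaluation it remains only to reassociate and to pull
  -- the multinomial coefficient out of the inner sum.
  totalCoefficient : Index m → Vec (Index m) n → Vec (Columns m) n → Carrier
  totalCoefficient i ks λs =
    i !ᵢ ÷ Vec.foldr′ ℕ._*_ 1 (Vec.map _!ᵢ ks) *
    KB.∏ᶠ (λ j → lookup ks j !ᵢ ÷ (𝔪[ lookup λs j ]! ℕ.* lookup λs j !ₚ)
                 * partitionMoment (ν j) (lookup λs j))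

  -- Equal monomials are not collected, although different families λ may have the same lengths. For
  -- a linear evaluation this form suffices, and it mirrors the double sum of the auxiliary moment.
  bell-expansion : ∀ i → bell ν i ≋
    (∑[ ks ∈ decompositions n i ] ∑[ λs ∈ choices (Vec.map partitions ks) ]
      con (totalCoefficient i ks λs) ⊗ var ^ᵐ Vec.map List.length λs)
  bell-expansion i = begin
    -- `bellExponent ν` unfolds to the sum of the `summand j`, so this line is `bell ν i` by
    -- definition.
    con (fromℕ (i !ᵢ)) ⊗ expₛ (λ k → ∑ᶠ (λ j → summand j k)) i
      ≈⟨ X.*-congˡ (expₛ-∑ᶠ n summand summand-0 i) ⟩
    con (fromℕ (i !ᵢ)) ⊗ (∑[ ks ∈ decompositions n i ] ∏ᶠ (λ j → expₛ (summand j) (lookup ks j)))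
      ≈⟨ ∑-*ˡ (decompositions n i) _ _ ⟩
    (∑[ ks ∈ decompositions n i ] con (fromℕ (i !ᵢ)) ⊗ ∏ᶠ (λ j → expₛ (summand j) (lookup ks j)))
      ≈⟨ fold-cong (decompositions n i) (λ ks → block ks) ⟩
    (∑[ ks ∈ decompositions n i ] ∑[ λs ∈ choices (Vec.map partitions ks) ]
      con (totalCoefficient i ks λs) ⊗ var ^ᵐ Vec.map List.length λs) ∎
    where
    open RingSums polys using (∑-*ˡ)
    open ListFold X.+-commutativeMonoid using (fold-cong)
    open CommutativeMonoidSum X.*-commutativeMonoid using (sum-cong-≋; ∑-distrib-+)

    term : Fin n → Columns m → Poly (Fin n)
    term j λs = con (coefficient j λs) ⊗ var j ^ List.length λs

    product-term : ∀ ks λs → con (fromℕ (i !ᵢ)) ⊗ ∏ᶠ (λ j → term j (lookup λs j)) ≋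
                             con (totalCoefficient i ks λs) ⊗ var ^ᵐ Vec.map List.length λs
    product-term ks λs = begin
      con (fromℕ (i !ᵢ)) ⊗ ∏ᶠ (λ j → term j (lookup λs j))
        ≈⟨ X.*-congˡ (∑-distrib-+ (λ j → con (coefficient j (lookup λs j))) (λ j → var j ^ List.length (lookup λs j))) ⟩
      con (fromℕ (i !ᵢ)) ⊗ (∏ᶠ (λ j → con (coefficient j (lookup λs j))) ⊗ ∏ᶠ (λ j → var j ^ List.length (lookup λs j)))
        ≈⟨ X.*-assoc _ _ _ ⟨
      con (fromℕ (i !ᵢ)) ⊗ ∏ᶠ (λ j → con (coefficient j (lookup λs j))) ⊗ ∏ᶠ (λ j → var j ^ List.length (lookup λs j))
        ≈⟨ ⊗-cong
             (≋-trans (X.*-congˡ (≋-sym (con-∏ᶠ (λ j → coefficient j (lookup λs j)))))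
               (≋-trans (≋-sym (con-⊗ _ _)) (con-cong (multinomial-cancel (i !ᵢ) ks
                 (λ j → 𝔪[ lookup λs j ]! ℕ.* lookup λs j !ₚ) (λ j → partitionMoment (ν j) (lookup λs j))))))
             (sum-cong-≋ {n} (λ j → X.reflexive (≡.cong (var j ^_) (≡.sym (Vecₚ.lookup-map j List.length λs))))) ⟩
      con (totalCoefficient i ks λs) ⊗ var ^ᵐ Vec.map List.length λs ∎

    block : ∀ ks → con (fromℕ (i !ᵢ)) ⊗ ∏ᶠ (λ j → expₛ (summand j) (lookup ks j)) ≋
      (∑[ λs ∈ choices (Vec.map partitions ks) ]
        con (totalCoefficient i ks λs) ⊗ var ^ᵐ Vec.map List.length λs)
    block ks = begin
      con (fromℕ (i !ᵢ)) ⊗ ∏ᶠ (λ j → expₛ (summand j) (lookup ks j))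
        ≈⟨ X.*-congˡ (sum-cong-≋ {n} (λ j → ≋-trans (expₛ-summand j (lookup ks j))
             (X.reflexive (≡.cong (λ ps → ∑ ps (term j)) (≡.sym (Vecₚ.lookup-map j partitions ks)))))) ⟩
      con (fromℕ (i !ᵢ)) ⊗ ∏ᶠ (λ j → ∑ (lookup (Vec.map partitions ks) j) (term j))
        ≈⟨ X.*-congˡ (∏ᶠ-∑ (Vec.map partitions ks) term) ⟩
      con (fromℕ (i !ᵢ)) ⊗ (∑[ λs ∈ choices (Vec.map partitions ks) ] ∏ᶠ (λ j → term j (lookup λs j)))
        ≈⟨ ∑-*ˡ (choices (Vec.map partitions ks)) _ _ ⟩
      (∑[ λs ∈ choices (Vec.map partitions ks) ] con (fromℕ (i !ᵢ)) ⊗ ∏ᶠ (λ j → term j (lookup λs j)))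
        ≈⟨ fold-cong (choices (Vec.map partitions ks)) (product-term ks) ⟩
      (∑[ λs ∈ choices (Vec.map partitions ks) ]
        con (totalCoefficient i ks λs) ⊗ var ^ᵐ Vec.map List.length λs) ∎

  module _ (μ : Fin n → Monomial A) where
    private
      σ : Fin n → Poly A
      σ j = ⟦ μ j ⟧

    E[_] : Poly (Fin n) → Carrier
    E[ p ] = E (p [ σ ])

    -- Homogeneity with scalar zero, after writing the zero polynomial as a multiple of itself.
    E[]-0 : E[ con 0# ] ≈ 0#
    E[]-0 = K.trans (E-cong (≋-sym (CommutativeRing.zeroˡ (polyRing A) (con 0#))))
      (K.trans (E-scalar 0# (con 0#)) (K.zeroˡ _))

    E[]-∑ : (xs : List B) (f : B → Poly (Fin n)) → E[ ∑ xs f ] ≈ KB.∑ xs (λ x → E[ f x ])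
    E[]-∑ = fold-homo X.+-commutativeMonoid K.+-commutativeMonoid E[_] E[]-0 (λ p q → E-additive _ _)

    E[]-monomial : ∀ k → E[ var ^ᵐ k ] ≈ moment μ k
    E[]-monomial k = K.reflexive (≡.cong E (≡.trans
      (∏ᶠ-[] σ (λ j → var j ^ lookup k j))
      (sum-cong-≗ {n} (λ j → ^-[] σ (var j) (lookup k j)))))
      where open CommutativeMonoidSum (CommutativeRing.*-commutativeMonoid (polyRing A)) using (sum-cong-≗)

    E[bell] : ∀ i → E[ bell ν i ] ≈ auxiliaryMoment μ ν i
    E[bell] i = K.trans (E-cong ([]-cong σ (bell-expansion i)))
      (K.trans (E[]-∑ (decompositions n i) _)
        (KΣ.fold-cong (decompositions n i) (λ ks → K.trans (E[]-∑ (choices (Vec.map partitions ks)) _)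
          (K.trans
            (KΣ.fold-cong (choices (Vec.map partitions ks)) (λ λs →
              K.trans (E-scalar (totalCoefficient i ks λs) _)
                (K.trans (K.*-congˡ (E[]-monomial (Vec.map List.length λs))) (K.*-assoc _ _ _))))
            (K.sym (RingSums.∑-*ˡ commutativeRing (choices (Vec.map partitions ks)) _ _))))))
      where module KΣ = ListFold K.+-commutativeMonoid

corollary3p2 : ∀ {c ℓ₁ ℓ₂ a} (K : CharacteristicZeroField c ℓ₁ ℓ₂) {A : Set a} (ev : Evaluation K A)
    {m n : ℕ} (μ : Fin n → Monomial A) (ν : Fin n → Fin m → Monomial A) (i : Index m) →
    let open CharacteristicZeroField K
        open Polynomials commutativeRing
        open Evaluation ev
        open Umbral K ev
    in E (bell ν i [ (λ j → ⟦ μ j ⟧) ]) ≈ auxiliaryMoment μ ν i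
corollary3p2 K ev μ ν i = BellMoments.E[bell] K ev ν μ i
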